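{- Let $G_1=(V_1,E_1)$ and $G_2=(V_2,E_2)$ be bispanning graphs and $G=G_1\oplus_2G_2$ their $2$-clique sum at join edges $d_1\in E_1$, $d_2\in E_2$. Let $(S,T)$ be a pair of disjoint spanning trees of $G$ with $S\cup T=E(G)$, and let $(S_1,T_1)$ and $(S_2,T_2)$ be pairs of disjoint spanning trees of $G_1$ and $G_2$ covering $E_1$ and $E_2$ respectively, with $S=(S_1\cup S_2)\setminus\{d_1,d_2\}$ and $T=(T_1\cup T_2)\setminus\{d_1,d_2\}$. If a unique exchange cyclic base ordering exists for $G_1$ and $(S_1,T_1)$ and one exists for $G_2$ and $(S_2,T_2)$, then a unique exchange cyclic base ordering exists for $G$ and $(S,T)$.
   Context: Graphs are finite, undirected, may have parallel edges, no loops; bispanning means the edge set is the disjoint union of two spanning trees. The $2$-clique sum at $d_1,d_2$: in the disjoint union identify the ends of $d_1$ bijectively with those of $d_2$, then delete $d_1,d_2$. For a spanning tree $T$ and $e\notin T$, $C_H(T,e)$ is the unique cycle in $T+e$; for a spanning tree $S$ and $e\in S$, $D_H(S,e)$ is the set of edges joining the two components of $S-e$. For an ordered pair $(X,Y)$ of disjoint spanning trees covering $E(H)$, $(e,f)$ is a unique $X$ exchange if $e\in X,f\in Y$, $D_H(X,e)\cap C_H(Y,e)=\{e,f\}$, and a unique $Y$ exchange if $e\in Y,f\in X$, $D_H(Y,e)\cap C_H(X,e)=\{e,f\}$. With $m=|E(H)|/2$, a unique exchange cyclic base ordering of $H$ and $(S,T)$ is a sequence $\langle(e_1,f_1),\ldots,(e_m,f_m)\rangle$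 for which there are enumerations $S=\{s_1,\ldots,s_m\}$, $T=\{t_1,\ldots,t_m\}$ such that for each $i$, $(e_i,f_i)\in\{(s_i,t_i),(t_i,s_i)\}$ is a unique $X_i$ or $Y_i$ exchange for $(X_i,Y_i)=(\{s_i,\ldots,s_m,t_1,\ldots,t_{i-1}\},\{t_i,\ldots,t_m,s_1,\ldots,s_{i-1}\})$. -}

module Defs where

open import Data.Nat using (ℕ; suc)
open import Data.Nat.DivMod using (_/_)
open import Data.Fin using (Fin; zero; suc; inject₁; fromℕ; _≤_; _<_)
open import Data.Product using (Σ; ∃; _×_; _,_; proj₁; proj₂)
open import Data.Sum using (_⊎_; inj₁; inj₂)
open import Data.Empty using (⊥)
open import Relation.Nullary using (¬_)
open import Relation.Binary.PropositionalEquality using (_≡_; _≢_)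
open import Function.Definitions using (Injective)
open import Function.Bundles using (_⇔_; _↔_; Inverse)

-- Finite undirected multigraphs without loops.
-- Vertices are Fin nV, edges are Fin nE; each edge has two distinct ends
-- (stored as an ordered pair, but only used through the symmetric Joins).

record Graph : Set where
  field
    nV nE  : ℕ
    ends   : Fin nE → Fin nV × Fin nV
    noLoop : ∀ e → proj₁ (ends e) ≢ proj₂ (ends e)

open Graph public

Vtx : Graph → Set
Vtx G = Fin (nV G)

Edge : Graph → Set
Edge G = Fin (nE G)

Joins : (G : Graph) → Edge G → Vtx G → Vtx G → Set
Joins G e u v = ends G e ≡ (u , v) ⊎ ends G e ≡ (v , u)

EdgeSet : Graph → Set₁
EdgeSet G = Edge G → Set

_-ₑ_ : {G : Graph} → EdgeSet G → Edge G → EdgeSet G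
(A -ₑ e) g = A g × g ≢ e

_+ₑ_ : {G : Graph} → EdgeSet G → Edge G → EdgeSet G
(A +ₑ e) g = A g ⊎ g ≡ e

data Reach (G : Graph) (A : EdgeSet G) : Vtx G → Vtx G → Set where
  here : ∀ {u} → Reach G A u u
  step : ∀ {u w v} (e : Edge G) → A e → Joins G e u w → Reach G A w v → Reach G A u v

Connected : (G : Graph) → EdgeSet G → Set
Connected G A = ∀ u v → Reach G A u v

record Cycle (G : Graph) (A : EdgeSet G) : Set where
  field
    len      : ℕ
    vs       : Fin (suc (suc len)) → Vtx G
    cs       : Fin (suc len) → Edge G
    closed   : vs (fromℕ (suc len)) ≡ vs zero
    vsInj    : Injective _≡_ _≡_ (λ i → vs (inject₁ i))
    csInj    : Injective _≡_ _≡_ cs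
    csIn     : ∀ i → A (cs i)
    csJoins  : ∀ i → Joins G (cs i) (vs (inject₁ i)) (vs (suc i))

OnCycle : {G : Graph} {A : EdgeSet G} → Cycle G A → Edge G → Set
OnCycle C g = ∃ λ i → Cycle.cs C i ≡ g

SpanningTree : (G : Graph) → EdgeSet G → Set
SpanningTree G A = Connected G A × ¬ Cycle G A

IsBispanningPair : (G : Graph) → EdgeSet G → EdgeSet G → Set
IsBispanningPair G S T =
  SpanningTree G S × SpanningTree G T × (∀ g → S g ⊎ T g) × (∀ g → ¬ (S g × T g))

Bispanning : Graph → Set₁
Bispanning G = Σ (EdgeSet G) λ S → Σ (EdgeSet G) λ T → IsBispanningPair G S T

-- D_H(S,e): edges joining the two components of S - e, i.e. edges whose
-- ends are not connected in S - e.
Cut : (G : Graph) → EdgeSet G → Edge G → EdgeSet G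
Cut G S e g = ¬ Reach G (_-ₑ_ {G} S e) (proj₁ (ends G g)) (proj₂ (ends G g))

-- (e , f) with e ∈ P, f ∈ Q and D(P,e) ∩ C(Q,e) = {e,f}, where C(Q,e) is
-- the (unique, Q being a spanning tree) cycle of Q + e.
-- A unique X exchange for (X,Y) is UniqueExch X Y; a unique Y exchange is UniqueExch Y X.
UniqueExch : (G : Graph) → EdgeSet G → EdgeSet G → Edge G → Edge G → Set
UniqueExch G P Q e f =
  P e × Q f ×
  Σ (Cycle G (_+ₑ_ {G} Q e)) λ C →
    ∀ g → (Cut G P e g × OnCycle C g) ⇔ (g ≡ e ⊎ g ≡ f)

UniqueXExchange : (G : Graph) → EdgeSet G → EdgeSet G → Edge G → Edge G → Set
UniqueXExchange G X Y e f = UniqueExch G X Y e f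

UniqueYExchange : (G : Graph) → EdgeSet G → EdgeSet G → Edge G → Edge G → Set
UniqueYExchange G X Y e f = UniqueExch G Y X e f

half : Graph → ℕ
half G = nE G / 2

-- X_i = {s_i..s_m} ∪ {t_1..t_{i-1}},  Y_i = {t_i..t_m} ∪ {s_1..s_{i-1}}  (0-indexed)
Xᵢ : (G : Graph) → (Fin (half G) → Edge G) → (Fin (half G) → Edge G) → Fin (half G) → EdgeSet G
Xᵢ G s t i g = (∃ λ j → i ≤ j × s j ≡ g) ⊎ (∃ λ j → j < i × t j ≡ g)

IsUECBO : (G : Graph) → EdgeSet G → EdgeSet G → (Fin (half G) → Edge G × Edge G) → Set
IsUECBO G S T seq =
  Σ (Fin (half G) → Edge G) λ s → Σ (Fin (half G) → Edge G) λ t →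
    Injective _≡_ _≡_ s × Injective _≡_ _≡_ t ×
    (∀ g → S g ⇔ (∃ λ i → s i ≡ g)) × (∀ g → T g ⇔ (∃ λ i → t i ≡ g)) ×
    (∀ i →
      (seq i ≡ (s i , t i) ⊎ seq i ≡ (t i , s i)) ×
      (UniqueXExchange G (Xᵢ G s t i) (Xᵢ G t s i) (proj₁ (seq i)) (proj₂ (seq i))
       ⊎ UniqueYExchange G (Xᵢ G s t i) (Xᵢ G t s i) (proj₁ (seq i)) (proj₂ (seq i))))

HasUECBO : (G : Graph) → EdgeSet G → EdgeSet G → Set
HasUECBO G S T = Σ (Fin (half G) → Edge G × Edge G) (IsUECBO G S T)

-- 2-clique sum, described up to isomorphism: G ≅ G₁ ⊕₂ G₂ at d₁, d₂.

SumEdge : (G₁ G₂ : Graph) → Edge G₁ → Edge G₂ → Set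
SumEdge G₁ G₂ d₁ d₂ = (Σ (Edge G₁) λ e → e ≢ d₁) ⊎ (Σ (Edge G₂) λ e → e ≢ d₂)

record TwoCliqueSum (G G₁ G₂ : Graph) (d₁ : Edge G₁) (d₂ : Edge G₂) : Set where
  x₁ = proj₁ (ends G₁ d₁)
  y₁ = proj₂ (ends G₁ d₁)
  x₂ = proj₁ (ends G₂ d₂)
  y₂ = proj₂ (ends G₂ d₂)
  field
    -- vertices: V(G) = (V₁ ⊔ V₂) / (ends of d₁ identified bijectively with ends of d₂)
    φ₁      : Vtx G₁ → Vtx G
    φ₂      : Vtx G₂ → Vtx G
    φ₁-inj  : Injective _≡_ _≡_ φ₁
    φ₂-inj  : Injective _≡_ _≡_ φ₂
    φ-surj  : ∀ v → (∃ λ u → φ₁ u ≡ v) ⊎ (∃ λ w → φ₂ w ≡ v)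
    glue    : (φ₁ x₁ ≡ φ₂ x₂ × φ₁ y₁ ≡ φ₂ y₂) ⊎ (φ₁ x₁ ≡ φ₂ y₂ × φ₁ y₁ ≡ φ₂ x₂)
    glueOnly : ∀ u w → φ₁ u ≡ φ₂ w → u ≡ x₁ ⊎ u ≡ y₁
    ψ       : Edge G ↔ SumEdge G₁ G₂ d₁ d₂
    ends₁   : ∀ g e (p : e ≢ d₁) → Inverse.to ψ g ≡ inj₁ (e , p) →
                Joins G g (φ₁ (proj₁ (ends G₁ e))) (φ₁ (proj₂ (ends G₁ e)))
    ends₂   : ∀ g e (p : e ≢ d₂) → Inverse.to ψ g ≡ inj₂ (e , p) →
                Joins G g (φ₂ (proj₁ (ends G₂ e))) (φ₂ (proj₂ (ends G₂ e)))

-- (A₁ ∪ A₂) \ {d₁, d₂}, transported to an edge set of G along ψ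
sumSet : {G G₁ G₂ : Graph} {d₁ : Edge G₁} {d₂ : Edge G₂} →
         TwoCliqueSum G G₁ G₂ d₁ d₂ → EdgeSet G₁ → EdgeSet G₂ → EdgeSet G
sumSet σ A₁ A₂ g = side (Inverse.to (TwoCliqueSum.ψ σ) g)
  where
  side : _ → Set
  side (inj₁ (e , _)) = A₁ e
  side (inj₂ (e , _)) = A₂ e

{-# OPTIONS --safe #-}

-- Record a pair (X, Y) of trees as a 2-colouring of the edges.  Since g ∈ C(Q,e) iff
-- e ∈ D(Q,g), unique exchanges can be described by fundamental cuts alone, and the cuts of
-- the sum are those of the summands: for h, g on the same side nothing changes, and for h
-- in G₁, g in G₂ one has g ∈ D(h) iff d₁ ∈ D₁(h) and g ∈ D₂(d₂).  As S and T are trees, d₁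
-- and d₂ have opposite colours, so exchanges avoiding d₁ and d₂ carry over to G, while an
-- exchange (d₁, p) in G₁ and an exchange (q, d₂) in G₂ merge into the exchange (q, p).
-- The two orderings are therefore interleaved around the exchanges that involve d₁ and d₂.
-- If d₁ and d₂ occur in the same position of their pairs, one ordering is reversed first:
-- this yields an ordering for the same pair of trees with every (e, f) turned into (f, e).
module Submission where

open import Defs
open import Data.Bool using (Bool; true; false; not) renaming (_≟_ to _≟ᵇ_)
open import Data.Bool.Properties using (not-involutive; not-injective; not-¬; ¬-not)
open import Data.Empty using (⊥; ⊥-elim)
open import Data.Fin using (Fin; zero; suc; inject₁; fromℕ; _≤_; _<_; _≟_; toℕ)
open import Data.Fin.Properties using (any?; *↔×; 2↔Bool; <-cmp; toℕ<n; toℕ-injective; suc-injective; inject₁-injective)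
open import Data.Fin.Permutation using (↔⇒≡)
open import Data.Nat using (ℕ; zero; suc; z≤n; s≤s)
open import Data.Nat.DivMod using (m*n/n≡m; _/_)
import Data.Nat as ℕ
import Data.Nat.Properties as ℕₚ
open import Data.Product using (Σ; ∃; _×_; _,_; proj₁; proj₂)
open import Data.Product.Function.NonDependent.Propositional using (_×-↔_)
open import Data.Unit using (⊤; tt)
open import Data.Sum using (_⊎_; inj₁; inj₂; [_,_]′)
open import Data.Sum.Properties using (inj₁-injective; inj₂-injective)
open import Function.Base using (_∘_; id; case_of_)
open import Function.Bundles using (_⇔_; _↔_; Equivalence; Inverse; mk⇔; mk↔ₛ′)
open import Function.Construct.Composition using (_↔-∘_; _⇔-∘_)
open import Function.Construct.Identity using (↔-id)
open import Function.Construct.Symmetry using (↔-sym)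
open import Function.Definitions using (Injective)
open import Relation.Binary.Definitions using (tri<; tri≈; tri>)
open import Relation.Nullary using (¬_; yes; no; contradiction)
open import Relation.Binary.PropositionalEquality using (_≡_; _≢_; _≗_; refl; sym; trans; cong; cong₂; subst)

open Equivalence using (to; from)

-- Reachability

-- The cut rules for the sum rest on d₁ and d₂ having opposite colours: then, in each colour, the
-- summand whose join edge has the other colour connects the glued vertices by edges of `G`. This
-- must survive in every intermediate colouring, so neither join edge may flip alone. The exchanges
-- preceding the critical one are therefore made in both summands, the two critical exchanges become
-- a single step that flips both join colours, and the remaining ones follow. Merging needs one join
-- edge first and the other second in its pair, because uniqueness of (e, f) tests only competitors
-- of the colour of f. For (d₁, p) and (q, d₂) these colours coincide; for (d₁, p) and (d₂, q) they
-- differ, and the two conditions do not combine. Reversal repairs this: a unique exchange (e, f),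
-- once made, is a unique exchange (f, e). The reversed sequence leads from (T, S) to (S, T), and
-- swapping the names of the colours restores the pair (S, T).

private
  variable
    G H : Graph

ends-joins : ∀ G e → Joins G e (proj₁ (ends G e)) (proj₂ (ends G e))
ends-joins G e = inj₁ refl

joins-sym : ∀ {e u v} → Joins G e u v → Joins G e v u
joins-sym = [ inj₂ , inj₁ ]′

joins-unique : ∀ {e u v u′ v′} → Joins G e u v → Joins G e u′ v′ →
               (u ≡ u′ × v ≡ v′) ⊎ (u ≡ v′ × v ≡ u′)
joins-unique (inj₁ p) (inj₁ q) with trans (sym p) q
... | refl = inj₁ (refl , refl)
joins-unique (inj₁ p) (inj₂ q) with trans (sym p) q
... | refl = inj₂ (refl , refl)
joins-unique (inj₂ p) (inj₁ q) with trans (sym p) q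
... | refl = inj₂ (refl , refl)
joins-unique (inj₂ p) (inj₂ q) with trans (sym p) q
... | refl = inj₁ (refl , refl)

_◅◅_ : {A : EdgeSet G} → ∀ {u v w} → Reach G A u v → Reach G A v w → Reach G A u w
here         ◅◅ q = q
step e a j p ◅◅ q = step e a j (p ◅◅ q)

-- An edge may become a whole walk, as is needed both for rerouting around an exchanged edge and for
-- replacing a join edge.
reach-map : {A : EdgeSet H} {B : EdgeSet G} (φ : Vtx H → Vtx G) →
            (∀ {e u w} → A e → Joins H e u w → Reach G B (φ u) (φ w)) →
            ∀ {u v} → Reach H A u v → Reach G B (φ u) (φ v)
reach-map φ F here           = here
reach-map φ F (step e a j p) = F a j ◅◅ reach-map φ F p

edge : {A : EdgeSet G} → ∀ {e u v} → A e → Joins G e u v → Reach G A u v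
edge a j = step _ a j here

reach-sym : {A : EdgeSet G} → ∀ {u v} → Reach G A u v → Reach G A v u
reach-sym here           = here
reach-sym {G} (step e a j p) = reach-sym p ◅◅ edge a (joins-sym {G} j)

reach-mono : {A B : EdgeSet G} → (∀ {e} → A e → B e) → ∀ {u v} → Reach G A u v → Reach G B u v
reach-mono A⊆B = reach-map id (λ a j → edge (A⊆B a) j)

Linked : (G : Graph) → EdgeSet G → Edge G → Set
Linked G A g = Reach G A (proj₁ (ends G g)) (proj₂ (ends G g))

linked⇒reach : ∀ {A : EdgeSet G} {g u v} → Joins G g u v → Linked G A g → Reach G A u v
linked⇒reach {G} {g = g} j l with joins-unique {G} {g} j (ends-joins G g)
... | inj₁ (refl , refl) = l
... | inj₂ (refl , refl) = reach-sym l

reach⇒linked : ∀ {A : EdgeSet G} {g u v} → Joins G g u v → Reach G A u v → Linked G A g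
reach⇒linked {G} {g = g} j p with joins-unique {G} {g} j (ends-joins G g)
... | inj₁ (refl , refl) = p
... | inj₂ (refl , refl) = reach-sym p

-- Any walk can be rerouted so as to use a given edge at most once.
reach-split : ∀ {A : EdgeSet G} (e : Edge G) {u v} → Reach G A u v →
              Reach G (_-ₑ_ {G} A e) u v ⊎
              ∃ λ a → ∃ λ b → Joins G e a b × Reach G (_-ₑ_ {G} A e) u a × Reach G (_-ₑ_ {G} A e) b v
reach-split e here = inj₁ here
reach-split {G} e (step f x j p) with f ≟ e | reach-split e p
... | no f≢e  | inj₁ q                     = inj₁ (step f (x , f≢e) j q)
... | no f≢e  | inj₂ (a , b , jab , q , r) = inj₂ (a , b , jab , step f (x , f≢e) j q , r)
... | yes refl | inj₁ q                    = inj₂ (_ , _ , j , here , q)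
... | yes refl | inj₂ (a , b , jab , q , r) with joins-unique {G} {e} j jab
...   | inj₁ (refl , refl) = inj₂ (_ , _ , jab , here , r)
...   | inj₂ (refl , refl) = inj₁ r

cut-mono : ∀ {A B : EdgeSet G} {e g} → (∀ {x} → B x → A x) → Cut G A e g → Cut G B e g
cut-mono B⊆A cut p = cut (reach-mono (λ (b , x≢e) → B⊆A b , x≢e) p)

-- Cycles versus reachability

module _ {G : Graph} {A : EdgeSet G} where

  length : ∀ {u v} → Reach G A u v → ℕ
  length here           = zero
  length (step _ _ _ p) = suc (length p)

  vertex : ∀ {u v} (p : Reach G A u v) → Fin (suc (length p)) → Vtx G
  vertex {u = u} p            zero    = u
  vertex (step _ _ _ p)       (suc i) = vertex p i

  edgeAt : ∀ {u v} (p : Reach G A u v) → Fin (length p) → Edge G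
  edgeAt (step e _ _ p) zero    = e
  edgeAt (step e _ _ p) (suc i) = edgeAt p i

  edgeAt-∈ : ∀ {u v} (p : Reach G A u v) i → A (edgeAt p i)
  edgeAt-∈ (step _ a _ p) zero    = a
  edgeAt-∈ (step _ _ _ p) (suc i) = edgeAt-∈ p i

  edgeAt-joins : ∀ {u v} (p : Reach G A u v) i →
                 Joins G (edgeAt p i) (vertex p (inject₁ i)) (vertex p (suc i))
  edgeAt-joins (step _ _ j here)           zero    = j
  edgeAt-joins (step _ _ j (step _ _ _ _)) zero    = j
  edgeAt-joins (step _ _ _ p) (suc i) = edgeAt-joins p i

  vertex-last : ∀ {u v} (p : Reach G A u v) → vertex p (fromℕ (length p)) ≡ v
  vertex-last here           = refl
  vertex-last (step _ _ _ p) = vertex-last p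

  data Simple : ∀ {u v} → Reach G A u v → Set where
    here : ∀ {u} → Simple (here {u = u})
    step : ∀ {u w v e a j} {p : Reach G A w v} → (∀ i → vertex p i ≢ u) → Simple p →
           Simple (step {u = u} e a j p)

  suffix : ∀ {u v} {p : Reach G A u v} → Simple p → ∀ i → Σ (Reach G A (vertex p i) v) Simple
  suffix {p = p} s          zero    = p , s
  suffix         (step _ s) (suc i) = suffix s i

  -- If the new first vertex recurs later, the closed part is cut off by starting at the recurrence.
  simplify : ∀ {u v} → Reach G A u v → Σ (Reach G A u v) Simple
  simplify here = here , here
  simplify {u} (step e a j p) with simplify p
  ... | q , s with any? (λ i → vertex q i ≟ u)
  ...   | yes (i , refl) = suffix s i
  ...   | no ∄i          = step e a j q , step (λ i eq → ∄i (i , eq)) s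

  vertex-injective : ∀ {u v} {p : Reach G A u v} → Simple p → Injective _≡_ _≡_ (vertex p)
  vertex-injective s          {zero}  {zero}  eq = refl
  vertex-injective (step n s) {zero}  {suc j} eq = contradiction (sym eq) (n j)
  vertex-injective (step n s) {suc i} {zero}  eq = contradiction eq (n i)
  vertex-injective (step n s) {suc i} {suc j} eq = cong suc (vertex-injective s eq)

  -- Both ends of every edge of `p` are vertices of `p`, whereas `e` has the end `u`, which `p`
  -- misses.
  edgeAt-≢ : ∀ {u v w} {p : Reach G A w v} → (∀ i → vertex p i ≢ u) →
             ∀ {e x i} → Joins G e u x → edgeAt p i ≢ e
  edgeAt-≢ {p = p} n {i = i} j refl with joins-unique {G} {edgeAt p i} (edgeAt-joins p i) j
  ... | inj₁ (eq , _) = n (inject₁ i) eq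
  ... | inj₂ (_ , eq) = n (suc i) eq

  edgeAt-injective : ∀ {u v} {p : Reach G A u v} → Simple p → Injective _≡_ _≡_ (edgeAt p)
  edgeAt-injective (step n s)         {zero}  {zero}  eq = refl
  edgeAt-injective (step {j = j} n s) {zero}  {suc k} eq = contradiction (sym eq) (edgeAt-≢ n j)
  edgeAt-injective (step {j = j} n s) {suc i} {zero}  eq = contradiction eq (edgeAt-≢ n j)
  edgeAt-injective (step n s)         {suc i} {suc k} eq = cong suc (edgeAt-injective s eq)

  reach⇒cycle : ∀ {e} → ¬ A e → Linked G A e → Σ (Cycle G (_+ₑ_ {G} A e)) λ C → OnCycle C e
  reach⇒cycle {e} e∉A l = cycle , zero , refl
    where
    v = proj₂ (ends G e)
    p = proj₁ (simplify l)
    p-simple = proj₂ (simplify l)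

    inject₁≢last : ∀ {n} (i : Fin n) → inject₁ i ≢ fromℕ n
    inject₁≢last zero    ()
    inject₁≢last (suc i) eq = inject₁≢last i (suc-injective eq)

    vs : Fin (suc (suc (length p))) → Vtx G
    vs zero    = v
    vs (suc i) = vertex p i

    cs : Fin (suc (length p)) → Edge G
    cs zero    = e
    cs (suc i) = edgeAt p i

    -- The walk ends at `v`, so by simplicity `v` sits at its last index only, which `inject₁` never
    -- attains.
    v≢ : ∀ i → v ≢ vertex p (inject₁ i)
    v≢ i eq = inject₁≢last i (vertex-injective p-simple (trans (sym eq) (sym (vertex-last p))))

    vsInj : Injective _≡_ _≡_ (λ i → vs (inject₁ i))
    vsInj {zero}  {zero}  eq = refl
    vsInj {zero}  {suc j} eq = contradiction eq (v≢ j)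
    vsInj {suc i} {zero}  eq = contradiction (sym eq) (v≢ i)
    vsInj {suc i} {suc j} eq = cong suc (inject₁-injective (vertex-injective p-simple eq))

    csInj : Injective _≡_ _≡_ cs
    csInj {zero}  {zero}  eq = refl
    csInj {zero}  {suc j} eq = contradiction (subst A (sym eq) (edgeAt-∈ p j)) e∉A
    csInj {suc i} {zero}  eq = contradiction (subst A eq (edgeAt-∈ p i)) e∉A
    csInj {suc i} {suc j} eq = cong suc (edgeAt-injective p-simple eq)

    cycle : Cycle G (_+ₑ_ {G} A e)
    cycle = record
      { len     = length p
      ; vs      = vs
      ; cs      = cs
      ; closed  = vertex-last p
      ; vsInj   = vsInj
      ; csInj   = csInj
      ; csIn    = λ { zero → inj₂ refl ; (suc i) → inj₁ (edgeAt-∈ p i) }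
      ; csJoins = λ { zero → joins-sym {G} (ends-joins G e) ; (suc i) → edgeAt-joins p i }
      }

module _ {G : Graph} {B : EdgeSet G} where

  walk-to : ∀ {n} (vs : Fin (suc n) → Vtx G) (cs : Fin n → Edge G) →
            (∀ i → Joins G (cs i) (vs (inject₁ i)) (vs (suc i))) →
            ∀ i → (∀ l → l < i → B (cs l)) → Reach G B (vs zero) (vs (inject₁ i))
  walk-to vs cs joins zero    inB = here
  walk-to vs cs joins (suc i) inB =
    step (cs zero) (inB zero (s≤s z≤n)) (joins zero)
      (walk-to (vs ∘ suc) (cs ∘ suc) (joins ∘ suc) i (λ l l<i → inB (suc l) (s≤s l<i)))

  walk-from : ∀ {n} (vs : Fin (suc n) → Vtx G) (cs : Fin n → Edge G) →
              (∀ i → Joins G (cs i) (vs (inject₁ i)) (vs (suc i))) →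
              ∀ i → (∀ l → i < l → B (cs l)) → Reach G B (vs (suc i)) (vs (fromℕ n))
  walk-from {suc zero} vs cs joins zero inB = here
  walk-from {suc (suc n)} vs cs joins zero inB =
    step (cs (suc zero)) (inB (suc zero) (s≤s z≤n)) (joins (suc zero))
      (walk-from (vs ∘ suc) (cs ∘ suc) (joins ∘ suc) zero (λ { (suc l) _ → inB (suc (suc l)) (s≤s z≤n) }))
  walk-from {suc n} vs cs joins (suc i) inB =
    walk-from (vs ∘ suc) (cs ∘ suc) (joins ∘ suc) i (λ l i<l → inB (suc l) (s≤s i<l))

-- The arc from the far end of the `k`-th edge to the closing vertex, followed by the arc from the
-- first vertex to the near end, avoids that edge because the edges of a cycle are distinct.
cycle⇒linked : ∀ {A : EdgeSet G} (C : Cycle G A) {g} → OnCycle C g →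
               Linked G (λ x → OnCycle C x × x ≢ g) g
cycle⇒linked {G} {A} C (k , refl) =
  reach⇒linked (joins-sym {G} (csJoins k))
    (subst (Reach G B _) closed
      (walk-from vs cs csJoins k (λ l k<l → (l , refl) , λ eq → ℕₚ.<⇒≢ k<l (cong toℕ (sym (csInj eq)))))
     ◅◅ walk-to vs cs csJoins k (λ l l<k → (l , refl) , λ eq → ℕₚ.<⇒≢ l<k (cong toℕ (csInj eq))))
  where
  open Cycle C
  B : EdgeSet G
  B x = OnCycle C x × x ≢ cs k

cycle-map : ∀ {A B : EdgeSet G} → (∀ {x} → A x → B x) → Cycle G A → Cycle G B
cycle-map A⊆B C = record { Cycle C ; csIn = λ i → A⊆B (Cycle.csIn C i) }

uniqueExch-resp : ∀ {P P′ Q Q′ : EdgeSet G} → (∀ {x} → P x ⇔ P′ x) → (∀ {x} → Q x ⇔ Q′ x) →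
                  ∀ {e f} → UniqueExch G P Q e f → UniqueExch G P′ Q′ e f
uniqueExch-resp {G} P⇔ Q⇔ {e} (Pe , Qf , C , char) =
  to P⇔ Pe , to Q⇔ Qf , cycle-map [ inj₁ ∘ to Q⇔ , inj₂ ]′ C , λ g →
  mk⇔ (λ (cut , on) → to (char g) (cut-mono {e = e} {g} (to P⇔) cut , on))
      (λ eq → let cut , on = from (char g) eq in cut-mono {e = e} {g} (from P⇔) cut , on)

-- Trees

-- The second component expresses acyclicity: no edge of A is spanned by the others.
Tree : (G : Graph) → EdgeSet G → Set
Tree G A = Connected G A × ∀ g → A g → Cut G A g g

spanningTree⇒tree : ∀ {A B : EdgeSet G} → (∀ {x} → A x ⇔ B x) → SpanningTree G A → Tree G B
spanningTree⇒tree {G} {A} {B} A⇔B (conn , acyc) =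
  (λ u v → reach-mono (to A⇔B) (conn u v)) ,
  λ g Bg l → acyc (cycle-map [ (λ (x , _) → from A⇔B x) , (λ { refl → from A⇔B Bg }) ]′
                     (proj₁ (reach⇒cycle (λ (_ , g≢g) → g≢g refl) l)))

tree-resp : ∀ {A B : EdgeSet G} → (∀ {x} → A x ⇔ B x) → Tree G A → Tree G B
tree-resp A⇔B (conn , acyc) =
  (λ u v → reach-mono (to A⇔B) (conn u v)) ,
  λ g Bg → cut-mono {e = g} {g} (from A⇔B) (acyc g (from A⇔B Bg))

module _ {G : Graph} {A : EdgeSet G} (A-tree : Tree G A) {e f : Edge G} (Ae : A e) (cut : Cut G A e f) where

  private
    A′ : EdgeSet G
    A′ = _+ₑ_ {G} (_-ₑ_ {G} A e) f

  -- By `cut`, the walk of `A` between the ends of `f` passes through `e`; its two remaining pieces,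
  -- joined by `f`, link the ends of `e`.
  exchange-linked : Linked G A′ e
  exchange-linked with reach-split e (proj₁ A-tree (proj₁ (ends G f)) (proj₂ (ends G f)))
  ... | inj₁ p = contradiction p cut
  ... | inj₂ (a , b , j , p , q) = reach⇒linked j
        (reach-mono inj₁ (reach-sym p) ◅◅ step f (inj₂ refl) (ends-joins G f) (reach-mono inj₁ (reach-sym q)))

  tree-exchange : Tree G A′
  tree-exchange = (λ u v → reach-map id reroute (proj₁ A-tree u v)) , acyclic
    where
    reroute : ∀ {x u w} → A x → Joins G x u w → Reach G A′ u w
    reroute {x} a j with x ≟ e
    ... | yes refl = linked⇒reach j exchange-linked
    ... | no x≢e   = edge (inj₁ (a , x≢e)) j

    acyclic : ∀ g → A′ g → Cut G A′ g g
    acyclic g (inj₂ refl) p = cut (reach-mono (λ { (inj₁ x , _) → x ; (inj₂ x≡f , x≢f) → contradiction x≡f x≢f }) p)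
    acyclic g (inj₁ (Ag , g≢e)) p with g ≟ f
    ... | yes refl = cut (edge (Ag , g≢e) (ends-joins G g))
    -- A walk avoiding `f` contradicts the acyclicity of `A`; the two pieces of a walk through `f`,
    -- joined by `g`, would link the ends of `f` without `e`, against `cut`.
    ... | no g≢f with reach-split f p
    ...   | inj₁ q = proj₂ A-tree g Ag
              (reach-mono (λ { ((inj₁ (x , _) , x≢g) , _) → x , x≢g ; ((inj₂ x≡f , _) , x≢f) → contradiction x≡f x≢f }) q)
    ...   | inj₂ (a , b , j , q , r) = cut (reach⇒linked j
              (reach-sym (reach-mono without-f q) ◅◅ step g (Ag , g≢e) (ends-joins G g) (reach-sym (reach-mono without-f r))))
      where
      without-f : ∀ {x} → (_-ₑ_ {G} (_-ₑ_ {G} A′ g) f) x → (_-ₑ_ {G} A e) x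
      without-f ((inj₁ x , _) , _)     = x
      without-f ((inj₂ x≡f , _) , x≢f) = contradiction x≡f x≢f

-- Colourings

Colouring : Graph → Set
Colouring G = Edge G → Bool

Class : (G : Graph) → Colouring G → Bool → EdgeSet G
Class G c b g = c g ≡ b

BiTree : (G : Graph) → Colouring G → Set
BiTree G c = ∀ b → Tree G (Class G c b)

-- Membership of g in the cycle C(Q,e) is expressed as e ∈ D(Q,g).
record Exchange (G : Graph) (c : Colouring G) (b : Bool) (e f : Edge G) : Set where
  field
    colour-e : c e ≡ b
    colour-f : c f ≡ not b
    cut-e    : Cut G (Class G c b) e f
    cut-f    : Cut G (Class G c (not b)) f e
    unique   : ∀ g → c g ≡ not b → Cut G (Class G c b) e g → Cut G (Class G c (not b)) g e → g ≡ f

open Exchange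

-- A relation instead of an update function, so that `c′` may be given independently, as a union of
-- colourings of the summands or by positions in an ordering.
record Flip (G : Graph) (c c′ : Colouring G) (e f : Edge G) : Set where
  field
    flip-e : c′ e ≡ not (c e)
    flip-f : c′ f ≡ not (c f)
    keep   : ∀ {g} → g ≢ e → g ≢ f → c′ g ≡ c g

open Flip

biTree-resp : ∀ {c c′ : Colouring G} → c ≗ c′ → BiTree G c → BiTree G c′
biTree-resp c≗c′ t b = tree-resp (λ {x} → mk⇔ (trans (sym (c≗c′ x))) (trans (c≗c′ x))) (t b)

-- Unique exchanges in terms of fundamental cuts

module _ {G : Graph} {c : Colouring G} {b : Bool} {e f : Edge G} (c-tree : BiTree G c) where

  private
    P Q : EdgeSet G
    P = Class G c b
    Q = Class G c (not b)

  Q⇒∉P : ∀ {x} → Q x → ¬ P x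
  Q⇒∉P q p = not-¬ p q

  -- If e could be bypassed in Q - g, then so could g.
  onCycle⇒cut : (C : Cycle G (_+ₑ_ {G} Q e)) → ∀ {g} → Q g → OnCycle C g → Cut G Q g e
  onCycle⇒cut C {g} Qg on l = proj₂ (c-tree (not b)) g Qg (reach-map id reroute (cycle⇒linked C on))
    where
    reroute : ∀ {x u w} → OnCycle C x × x ≢ g → Joins G x u w → Reach G (_-ₑ_ {G} Q g) u w
    reroute ((i , refl) , x≢g) j with Cycle.csIn C i
    ... | inj₁ q  = edge (q , x≢g) j
    ... | inj₂ eq = linked⇒reach (subst (λ x → Joins G x _ _) eq j) l

  -- If the cycle missed `g`, its edges other than `e` would link the ends of `e` inside Q - g.
  cut⇒onCycle : (C : Cycle G (_+ₑ_ {G} Q e)) → OnCycle C e → ∀ {g} → Cut G Q g e → OnCycle C g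
  cut⇒onCycle C e-on {g} cut with any? (λ i → Cycle.cs C i ≟ g)
  ... | yes on = on
  ... | no off = contradiction (reach-mono rest (cycle⇒linked C e-on)) cut
    where
    rest : ∀ {x} → OnCycle C x × x ≢ e → (_-ₑ_ {G} Q g) x
    rest ((i , refl) , x≢e) with Cycle.csIn C i
    ... | inj₁ q  = q , λ eq → off (i , eq)
    ... | inj₂ eq = contradiction eq x≢e

  uniqueExch⇒exchange : UniqueExch G P Q e f → Exchange G c b e f
  uniqueExch⇒exchange (Pe , Qf , C , char) = record
    { colour-e = Pe
    ; colour-f = Qf
    ; cut-e    = proj₁ (from (char f) (inj₂ refl))
    ; cut-f    = onCycle⇒cut C Qf (proj₂ (from (char f) (inj₂ refl)))
    -- `char` at `e` places `e` on the given cycle, as `cut⇒onCycle` requires.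
    ; unique   = λ g Qg cut cut′ →
        [ (λ { refl → contradiction Pe (Q⇒∉P Qg) }) , id ]′
          (to (char g) (cut , cut⇒onCycle C (proj₂ (from (char e) (inj₁ refl))) cut′))
    }

  exchange⇒uniqueExch : Exchange G c b e f → UniqueExch G P Q e f
  exchange⇒uniqueExch x = colour-e x , colour-f x , C , λ g → mk⇔ (only g) (both g)
    where
    e∉Q : ¬ Q e
    e∉Q q = Q⇒∉P q (colour-e x)

    cycle = reach⇒cycle e∉Q (proj₁ (c-tree (not b)) _ _)
    C = proj₁ cycle

    only : ∀ g → Cut G P e g × OnCycle C g → g ≡ e ⊎ g ≡ f
    only g (cut , i , refl) with Cycle.csIn C i
    ... | inj₁ q  = inj₂ (unique x g q cut (onCycle⇒cut C q (i , refl)))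
    ... | inj₂ eq = inj₁ eq

    both : ∀ g → g ≡ e ⊎ g ≡ f → Cut G P e g × OnCycle C g
    both g (inj₁ refl) = proj₂ (c-tree b) e (colour-e x) , proj₂ cycle
    both g (inj₂ refl) = cut-e x , cut⇒onCycle C (proj₂ cycle) (cut-f x)

flip-swap : ∀ {c c′ : Colouring G} {e f} → Flip G c c′ e f → Flip G c c′ f e
flip-swap fl = record { flip-e = flip-f fl ; flip-f = flip-e fl ; keep = λ g≢f g≢e → keep fl g≢e g≢f }

class-flip : ∀ {c c′ : Colouring G} {b e f} → Flip G c c′ e f → c e ≡ b → c f ≡ not b →
             ∀ {g} → (_+ₑ_ {G} (_-ₑ_ {G} (Class G c b) e) f) g ⇔ Class G c′ b g
class-flip {G} {c} {c′} {b} {e} {f} fl ce cf {g} = mk⇔ there back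
  where
  c′f : c′ f ≡ b
  c′f = trans (flip-f fl) (trans (cong not cf) (not-involutive b))

  there : (_+ₑ_ {G} (_-ₑ_ {G} (Class G c b) e) f) g → Class G c′ b g
  there (inj₂ refl) = c′f
  there (inj₁ (cg , g≢e)) with g ≟ f
  ... | yes refl = c′f
  ... | no g≢f   = trans (keep fl g≢e g≢f) cg

  back : Class G c′ b g → (_+ₑ_ {G} (_-ₑ_ {G} (Class G c b) e) f) g
  back c′g with g ≟ f | g ≟ e
  ... | yes g≡f | _        = inj₂ g≡f
  ... | no g≢f  | no g≢e   = inj₁ (trans (sym (keep fl g≢e g≢f)) c′g , g≢e)
  ... | no g≢f  | yes refl =
        contradiction (trans (sym c′g) (trans (flip-e fl) (cong not ce))) (not-¬ refl)

-- Making an exchange and undoing it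

module _ {G : Graph} {c c′ : Colouring G} {b : Bool} {e f : Edge G}
         (c-tree : BiTree G c) (x : Exchange G c b e f) (flip : Flip G c c′ e f) where

  private
    class-b : ∀ {g} → (_+ₑ_ {G} (_-ₑ_ {G} (Class G c b) e) f) g ⇔ Class G c′ b g
    class-b = class-flip flip (colour-e x) (colour-f x)

    class-not-b : ∀ {g} → (_+ₑ_ {G} (_-ₑ_ {G} (Class G c (not b)) f) e) g ⇔ Class G c′ (not b) g
    class-not-b = class-flip (flip-swap flip) (colour-f x) (trans (colour-e x) (sym (not-involutive b)))

  -- `cut-e` permits the tree exchange in the class of colour `b`, `cut-f` the one in the other
  -- class.
  biTree-flip : BiTree G c′
  biTree-flip b′ with b′ ≟ᵇ b
  ... | yes refl = tree-resp class-b (tree-exchange (c-tree b) (colour-e x) (cut-e x))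
  ... | no b′≢b  = subst (λ z → Tree G (Class G c′ z)) (sym (¬-not b′≢b))
                     (tree-resp class-not-b (tree-exchange (c-tree (not b)) (colour-f x) (cut-f x)))

  -- D(X-e+f, f) = D(X, e) and C(Y-f+e, f) = C(Y, e).
  exchange-reverse : Exchange G c′ b f e
  exchange-reverse = record
    { colour-e = to class-b (inj₂ refl)
    ; colour-f = to class-not-b (inj₂ refl)
    ; cut-e    = λ p → proj₂ (c-tree b) e (colour-e x) (reach-mono class-b-f p)
    ; cut-f    = λ p → proj₂ (c-tree (not b)) f (colour-f x) (reach-mono class-not-b-e p)
    ; unique   = uniq
    }
    where
    class-b-f : ∀ {g} → (_-ₑ_ {G} (Class G c′ b) f) g → (_-ₑ_ {G} (Class G c b) e) g
    class-b-f (c′g , g≢f) with from class-b c′g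
    ... | inj₁ y   = y
    ... | inj₂ g≡f = contradiction g≡f g≢f

    class-not-b-e : ∀ {g} → (_-ₑ_ {G} (Class G c′ (not b)) e) g → (_-ₑ_ {G} (Class G c (not b)) f) g
    class-not-b-e (c′g , g≢e) with from class-not-b c′g
    ... | inj₁ y   = y
    ... | inj₂ g≡e = contradiction g≡e g≢e

    uniq : ∀ g → c′ g ≡ not b → Cut G (Class G c′ b) f g → Cut G (Class G c′ (not b)) g f → g ≡ e
    uniq g c′g cut cut′ with from class-not-b c′g
    ... | inj₂ g≡e = g≡e
    ... | inj₁ (cg , g≢f) with g ≟ e
    ...   | yes g≡e = g≡e
    ...   | no g≢e  = contradiction (unique x g cg cut₁ cut₂) g≢f
      where
      cut₁ : Cut G (Class G c b) e g
      cut₁ p = cut (reach-mono (λ { {y} (cy , y≢e) → to class-b (inj₁ (cy , y≢e)) ,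
                 λ { refl → not-¬ cy (colour-f x) } }) p)

      into : ∀ {y} → (_-ₑ_ {G} (_-ₑ_ {G} (Class G c (not b)) g) f) y → (_-ₑ_ {G} (Class G c′ (not b)) g) y
      into ((cy , y≢g) , y≢f) = to class-not-b (inj₁ (cy , y≢f)) , y≢g

      -- By `cut-f`, a walk between the ends of `e` that avoids `g` must use `f`; its two pieces and
      -- `e` then link the ends of `f` in the new class without `g`.
      cut₂ : Cut G (Class G c (not b)) g e
      cut₂ p with reach-split f p
      ... | inj₁ q = cut-f x (reach-mono (λ ((cy , _) , y≢f) → cy , y≢f) q)
      ... | inj₂ (_ , _ , j , q , r) = cut′ (reach⇒linked j
            (reach-sym (reach-mono into q) ◅◅
             step e (to class-not-b (inj₂ refl) , λ { refl → g≢e refl }) (ends-joins G e)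
               (reach-sym (reach-mono into r))))

-- A run read backwards starts at the complement of `c₀`; renaming the colours makes it start at
-- `c₀` again.
exchange-complement : ∀ {c : Colouring G} {b e f} → Exchange G c b e f → Exchange G (not ∘ c) (not b) e f
exchange-complement {e = e} {f} x = record
  { colour-e = cong not (colour-e x)
  ; colour-f = cong not (colour-f x)
  ; cut-e    = cut-mono {e = e} {f} not-injective (cut-e x)
  ; cut-f    = cut-mono {e = f} {e} not-injective (cut-f x)
  ; unique   = λ g cg cut cut′ → unique x g (not-injective cg)
                 (cut-mono {e = e} {g} (cong not) cut) (cut-mono {e = g} {e} (cong not) cut′)
  }

flip-reverse : ∀ {c c′ : Colouring G} {e f} → Flip G c c′ e f → Flip G (not ∘ c′) (not ∘ c) f e
flip-reverse {c = c} fl = record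
  { flip-e = cong not (trans (sym (not-involutive _)) (cong not (sym (flip-f fl))))
  ; flip-f = cong not (trans (sym (not-involutive _)) (cong not (sym (flip-e fl))))
  ; keep   = λ g≢f g≢e → cong not (sym (keep fl g≢e g≢f))
  }

-- Exchange sequences

-- `Ok` restricts the edges taking part: `Other d` marks the stretches of an ordering that leave the
-- join edge `d` alone.
record Step (G : Graph) (c₀ : Colouring G) (Ok : EdgeSet G) (c c′ : Colouring G) : Set where
  field
    {b}      : Bool
    {e f}    : Edge G
    exchange : Exchange G c b e f
    flip     : Flip G c c′ e f
    fresh-e  : c e ≡ c₀ e
    fresh-f  : c f ≡ c₀ f
    ok-e     : Ok e
    ok-f     : Ok f

-- A run flips each edge at most once: an edge can be exchanged only while it has
-- its colour under c₀.
data Run (G : Graph) (c₀ : Colouring G) (Ok : EdgeSet G) : ℕ → Colouring G → Colouring G → Set where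
  done : ∀ {c} → Run G c₀ Ok zero c c
  next : ∀ {n c c′ c″} → Step G c₀ Ok c c′ → Run G c₀ Ok n c′ c″ → Run G c₀ Ok (suc n) c c″

Always : ∀ {G} → EdgeSet G
Always _ = ⊤

Other : ∀ {G} → Edge G → EdgeSet G
Other d g = g ≢ d

-- Reaching the complement of `c₀` while no edge flips twice means that each edge flips exactly
-- once. The length is left open and recovered later by counting edges.
record Ordering (G : Graph) (c₀ : Colouring G) : Set where
  field
    {n}    : ℕ
    {c c′} : Colouring G
    run    : Run G c₀ (Always {G}) n c c′
    start  : c ≗ c₀
    end    : c′ ≗ not ∘ c₀

module _ {G : Graph} {c₀ : Colouring G} {Ok : EdgeSet G} where

  -- Sorts the pair by colour instead of by role: `true` yields the member of S and `false` that of
  -- T, whichever of them is `e`.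
  pick : ∀ {c c′} → Step G c₀ Ok c c′ → Bool → Edge G
  pick s b′ with b′ ≟ᵇ Step.b s
  ... | yes _ = Step.e s
  ... | no _  = Step.f s

  module _ {c c′ : Colouring G} (s : Step G c₀ Ok c c′) where
    open Step s

    pick-before : ∀ b′ → c (pick s b′) ≡ b′
    pick-before b′ with b′ ≟ᵇ b
    ... | yes refl = colour-e exchange
    ... | no b′≢b  = trans (colour-f exchange) (sym (¬-not b′≢b))

    pick-colour : ∀ b′ → c₀ (pick s b′) ≡ b′
    pick-colour b′ with b′ ≟ᵇ b
    ... | yes refl = trans (sym fresh-e) (colour-e exchange)
    ... | no b′≢b  = trans (sym fresh-f) (trans (colour-f exchange) (sym (¬-not b′≢b)))

    pick-after : ∀ b′ → c′ (pick s b′) ≡ not b′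
    pick-after b′ with b′ ≟ᵇ b
    ... | yes refl = trans (flip-e flip) (cong not (colour-e exchange))
    ... | no b′≢b  = trans (flip-f flip) (cong not (trans (colour-f exchange) (sym (¬-not b′≢b))))

    pick-b : pick s b ≡ e
    pick-b with b ≟ᵇ b
    ... | yes _  = refl
    ... | no b≢b = contradiction refl b≢b

    pick-not-b : pick s (not b) ≡ f
    pick-not-b with not b ≟ᵇ b
    ... | yes eq = contradiction (sym eq) (not-¬ refl)
    ... | no _   = refl

    picked? : ∀ g → pick s (c₀ g) ≡ g ⊎ c′ g ≡ c g
    picked? g with g ≟ e | g ≟ f
    ... | yes refl | _        = inj₁ (trans (cong (pick s) (trans (sym fresh-e) (colour-e exchange))) pick-b)
    ... | no _     | yes refl = inj₁ (trans (cong (pick s) (trans (sym fresh-f) (colour-f exchange))) pick-not-b)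
    ... | no g≢e   | no g≢f   = inj₂ (keep flip g≢e g≢f)

    step-settled : ∀ {g} → c g ≡ not (c₀ g) → c′ g ≡ not (c₀ g)
    step-settled {g} cg with picked? g
    ... | inj₁ eq = trans (cong c′ (sym eq)) (pick-after (c₀ g))
    ... | inj₂ eq = trans eq cg

    step-unsettled : ∀ {g} → c′ g ≡ c₀ g → c g ≡ c₀ g
    step-unsettled {g} c′g with picked? g
    ... | inj₁ eq = trans (cong c (sym eq)) (pick-before (c₀ g))
    ... | inj₂ eq = trans (sym eq) c′g

  step-biTree : ∀ {c c′} → Step G c₀ Ok c c′ → BiTree G c → BiTree G c′
  step-biTree s t = biTree-flip t (Step.exchange s) (Step.flip s)

  run-biTree : ∀ {n c c′} → Run G c₀ Ok n c c′ → BiTree G c → BiTree G c′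
  run-biTree done       t = t
  run-biTree (next s r) t = run-biTree r (step-biTree s t)

  _+++_ : ∀ {m n c c′ c″} → Run G c₀ Ok m c c′ → Run G c₀ Ok n c′ c″ → Run G c₀ Ok (m ℕ.+ n) c c″
  done     +++ q = q
  next s r +++ q = next s (r +++ q)

  snoc : ∀ {n c c′ c″} → Run G c₀ Ok n c c′ → Step G c₀ Ok c′ c″ → Run G c₀ Ok (suc n) c c″
  snoc done       t = next t done
  snoc (next s r) t = next s (snoc r t)

  step-reverse : ∀ {c c′} → BiTree G c → Step G c₀ Ok c c′ → Step G c₀ Ok (not ∘ c′) (not ∘ c)
  step-reverse t s = record
    { exchange = exchange-complement (exchange-reverse t exchange flip)
    ; flip     = flip-reverse flip
    ; fresh-e  = trans (cong not (flip-f flip)) (trans (not-involutive _) fresh-f)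
    ; fresh-f  = trans (cong not (flip-e flip)) (trans (not-involutive _) fresh-e)
    ; ok-e     = ok-f
    ; ok-f     = ok-e
    }
    where open Step s

  run-reverse : ∀ {n c c′} → BiTree G c → Run G c₀ Ok n c c′ → Run G c₀ Ok n (not ∘ c′) (not ∘ c)
  run-reverse t done       = done
  run-reverse t (next s r) = snoc (run-reverse (step-biTree s t) r) (step-reverse t s)

-- An ordering split at the exchange in which the edge d takes part.
record Passage (G : Graph) (c₀ : Colouring G) (Meets : Edge G → Edge G → Set) (d : Edge G) : Set where
  field
    {m n}             : ℕ
    {c c₁ c₂ c′}      : Colouring G
    before            : Run G c₀ (Other {G} d) m c c₁
    crossing          : Step G c₀ (Always {G}) c₁ c₂
    after             : Run G c₀ (Other {G} d) n c₂ c′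
    meets             : Meets (Step.e crossing) (Step.f crossing)
    start             : c ≗ c₀
    end               : c′ ≗ not ∘ c₀

Leads Follows : ∀ {G} → Edge G → Edge G → Edge G → Set
Leads   d e f = e ≡ d
Follows d e f = f ≡ d

passage-reverse : ∀ {c₀ : Colouring G} {d} {M N : Edge G → Edge G → Set} → (∀ {e f} → M e f → N f e) →
                  BiTree G c₀ → Passage G c₀ M d → Passage G c₀ N d
passage-reverse M⇒N t p = record
  { before   = run-reverse t₂ after
  ; crossing = step-reverse t₁ crossing
  ; after    = run-reverse t₀ before
  ; meets    = M⇒N meets
  ; start    = λ g → trans (cong not (end g)) (not-involutive _)
  ; end      = λ g → cong not (start g)
  }
  where
  open Passage p
  t₀ = biTree-resp (λ g → sym (start g)) t
  t₁ = run-biTree before t₀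
  t₂ = step-biTree crossing t₁

module _ {G : Graph} {c₀ : Colouring G} (d : Edge G) where

  weaken : ∀ {c c′} (s : Step G c₀ (Always {G}) c c′) → Step.e s ≢ d → Step.f s ≢ d → Step G c₀ (Other {G} d) c c′
  weaken s e≢d f≢d = record { Step s ; ok-e = e≢d ; ok-f = f≢d }

  -- Once `d` has lost its initial colour, freshness bars it from all later steps.
  settled-avoids : ∀ {n c c′} → c d ≡ not (c₀ d) → Run G c₀ (Always {G}) n c c′ → Run G c₀ (Other {G} d) n c c′
  settled-avoids cd done       = done
  settled-avoids cd (next s r) =
    next (weaken s (λ { refl → not-¬ (Step.fresh-e s) cd }) (λ { refl → not-¬ (Step.fresh-f s) cd }))
      (settled-avoids (step-settled s cd) r)

  module _ {c′ : Colouring G} (end : c′ ≗ not ∘ c₀) where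

    -- The prefix read so far leaves `d` with its initial colour, whereas `end` gives it the other
    -- one, so a step using `d` must still come.
    locate : ∀ {m n c cₙ} → c ≗ c₀ → Run G c₀ (Other {G} d) m c cₙ → cₙ d ≡ c₀ d →
             Run G c₀ (Always {G}) n cₙ c′ →
             Passage G c₀ (Leads {G} d) d ⊎ Passage G c₀ (Follows {G} d) d
    locate start r cd done = contradiction (end d) (not-¬ cd)
    locate start r cd (next s r′) with Step.e s ≟ d | Step.f s ≟ d
    ... | yes refl | _ = inj₁ (record
          { before = r ; crossing = s ; meets = refl ; start = start ; end = end
          ; after = settled-avoids (trans (flip-e (Step.flip s)) (cong not cd)) r′ })
    ... | no _ | yes refl = inj₂ (record
          { before = r ; crossing = s ; meets = refl ; start = start ; end = end
          ; after = settled-avoids (trans (flip-f (Step.flip s)) (cong not cd)) r′ })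
    ... | no e≢d | no f≢d =
          locate start (snoc r (weaken s e≢d f≢d))
            (trans (keep (Step.flip s) (e≢d ∘ sym) (f≢d ∘ sym)) cd) r′

passage : ∀ {c₀ : Colouring G} d → Ordering G c₀ → Passage G c₀ (Leads {G} d) d ⊎ Passage G c₀ (Follows {G} d) d
passage d o = locate d end start done (start d) run
  where open Ordering o

-- Two-clique sums

-- A copy of H - d inside G; Over g e says that the edge g of G is the copy of e.
record Side (G H : Graph) (d : Edge H) : Set₁ where
  field
    φ          : Vtx H → Vtx G
    φ-inj      : Injective _≡_ _≡_ φ
    Over       : Edge G → Edge H → Set
    over-≢     : ∀ {g e} → Over g e → e ≢ d
    over-inj   : ∀ {g g′ e} → Over g e → Over g′ e → g ≡ g′
    over-fun   : ∀ {g e e′} → Over g e → Over g e′ → e ≡ e′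
    over-joins : ∀ {g e} → Over g e → Joins G g (φ (proj₁ (ends H e))) (φ (proj₂ (ends H e)))
    lift       : ∀ {e} → e ≢ d → ∃ λ g → Over g e

open Side

-- `seam` supplies the two glued pairs of vertices. `meet` says that nothing else is glued, in the
-- form that walks need: given one glued pair, it returns the opposite one.
record Glued {G G₁ G₂ : Graph} {d₁ : Edge G₁} {d₂ : Edge G₂} (σ₁ : Side G G₁ d₁) (σ₂ : Side G G₂ d₂) : Set where
  field
    cover    : ∀ g → (∃ λ e → Over σ₁ g e) ⊎ (∃ λ e → Over σ₂ g e)
    disjoint : ∀ {g e₁ e₂} → Over σ₁ g e₁ → Over σ₂ g e₂ → ⊥
    seam     : ∃ λ a₁ → ∃ λ b₁ → ∃ λ a₂ → ∃ λ b₂ →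
               Joins G₁ d₁ a₁ b₁ × Joins G₂ d₂ a₂ b₂ × φ σ₁ a₁ ≡ φ σ₂ a₂ × φ σ₁ b₁ ≡ φ σ₂ b₂
    meet     : ∀ {a₁ a₂} → φ σ₁ a₁ ≡ φ σ₂ a₂ →
               ∃ λ b₁ → ∃ λ b₂ → Joins G₁ d₁ a₁ b₁ × Joins G₂ d₂ a₂ b₂ × φ σ₁ b₁ ≡ φ σ₂ b₂

open Glued

glued-sym : ∀ {G G₁ G₂ d₁ d₂} {σ₁ : Side G G₁ d₁} {σ₂ : Side G G₂ d₂} → Glued σ₁ σ₂ → Glued σ₂ σ₁
glued-sym Γ = record
  { cover    = λ g → [ inj₂ , inj₁ ]′ (cover Γ g)
  ; disjoint = λ o₂ o₁ → disjoint Γ o₁ o₂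
  ; seam     = let a₁ , b₁ , a₂ , b₂ , j₁ , j₂ , p , q = seam Γ in
               a₂ , b₂ , a₁ , b₁ , j₂ , j₁ , sym p , sym q
  ; meet     = λ eq → let b₁ , b₂ , j₁ , j₂ , q = meet Γ (sym eq) in b₂ , b₁ , j₂ , j₁ , sym q
  }

module _ {G H : Graph} {d : Edge H} (σ : Side G H d) where

  over-joins′ : ∀ {g e u v} → Over σ g e → Joins H e u v → Joins G g (φ σ u) (φ σ v)
  over-joins′ {e = e} o j with joins-unique {H} {e} j (ends-joins H e)
  ... | inj₁ (refl , refl) = over-joins σ o
  ... | inj₂ (refl , refl) = joins-sym {G} (over-joins σ o)

  -- `d` has no copy in `G`, so a walk through it needs the substitute `viaD`, which will come from
  -- the other summand.
  lift-reach : ∀ {A : EdgeSet G} {B : EdgeSet H} →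
               (∀ {g e} → Over σ g e → B e → A g) →
               (∀ {u v} → B d → Joins H d u v → Reach G A (φ σ u) (φ σ v)) →
               ∀ {u v} → Reach H B u v → Reach G A (φ σ u) (φ σ v)
  lift-reach {A} {B} inA viaD = reach-map (φ σ) image
    where
    image : ∀ {e u w} → B e → Joins H e u w → Reach G A (φ σ u) (φ σ w)
    image {e} Be j with e ≟ d
    ... | yes refl = viaD Be j
    ... | no e≢d   = let g , o = lift σ e≢d in edge (inA o Be) (over-joins′ o j)

module _ {G G₁ G₂ : Graph} {d₁ : Edge G₁} {d₂ : Edge G₂} {σ₁ : Side G G₁ d₁} {σ₂ : Side G G₂ d₂}
         (Γ : Glued σ₁ σ₂) where

  bridge : ∀ {A : EdgeSet G} → (∀ {u v} → Joins G₂ d₂ u v → Reach G A (φ σ₂ u) (φ σ₂ v)) →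
           ∀ {u v} → Joins G₁ d₁ u v → Reach G A (φ σ₁ u) (φ σ₁ v)
  bridge {A} across j with seam Γ
  ... | a₁ , b₁ , a₂ , b₂ , j₁ , j₂ , p , q
      with joins-unique {G₁} {d₁} j j₁ | subst (λ x → Reach G A x (φ σ₁ b₁)) (sym p) (subst (Reach G A (φ σ₂ a₂)) (sym q) (across j₂))
  ...   | inj₁ (refl , refl) | r = r
  ...   | inj₂ (refl , refl) | r = reach-sym r

  -- A walk of G projects to G₁ once its excursions into G₂ are replaced by d₁.
  project-reach : ∀ {A : EdgeSet G} {B₁ : EdgeSet G₁} {B₂ : EdgeSet G₂} →
                  (∀ {g e} → Over σ₁ g e → A g → B₁ e) →
                  (∀ {g e} → Over σ₂ g e → A g → B₂ e) →
                  (Linked G₂ B₂ d₂ → B₁ d₁) →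
                  ∀ {u v} → Reach G A (φ σ₁ u) (φ σ₁ v) → Reach G₁ B₁ u v
  project-reach {A} {B₁} {B₂} in₁ in₂ viaD {v = v} = λ p → proj₁ (walk p) refl
    where
    -- Inside `G₂` the projected walk stays in `G₂` up to a glued vertex and continues from there in
    -- `G₁`. A glued vertex can be read on either side, so `At` carries both readings through the
    -- induction.
    Exit : Vtx G₂ → Set
    Exit a₂ = ∃ λ z₁ → ∃ λ z₂ → φ σ₁ z₁ ≡ φ σ₂ z₂ × Reach G₂ B₂ a₂ z₂ × Reach G₁ B₁ z₁ v

    At : Vtx G → Set
    At w = (∀ {u} → φ σ₁ u ≡ w → Reach G₁ B₁ u v) × (∀ {a₂} → φ σ₂ a₂ ≡ w → Exit a₂)

    at₁ : ∀ {u} → Reach G₁ B₁ u v → At (φ σ₁ u)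
    at₁ {u} r = (λ eq → subst (λ x → Reach G₁ B₁ x v) (sym (φ-inj σ₁ eq)) r) ,
                (λ eq → _ , _ , sym eq , here , r)

    at₂ : ∀ {a₂} → Exit a₂ → At (φ σ₂ a₂)
    at₂ {a₂} (z₁ , z₂ , z-eq , q , r) =
      enter , λ eq → subst Exit (sym (φ-inj σ₂ eq)) (z₁ , z₂ , z-eq , q , r)
      where
      enter : ∀ {u} → φ σ₁ u ≡ φ σ₂ a₂ → Reach G₁ B₁ u v
      enter {u} eq with meet Γ eq | meet Γ z-eq
      -- An excursion between equal glued vertices is dropped; one between opposite glued vertices
      -- links the ends of `d₂` and is replaced by `d₁`.
      ... | b₁ , b₂ , j₁ , j₂ , b-eq | _ , _ , i₁ , i₂ , _ with joins-unique {G₁} {d₁} j₁ i₁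
      ...   | inj₁ (refl , _) = r
      ...   | inj₂ (_ , refl) = step d₁ (viaD (reach⇒linked j₂ (subst (Reach G₂ B₂ a₂) z₂≡b₂ q))) j₁ r
        where
        z₂≡b₂ : z₂ ≡ b₂
        z₂≡b₂ = φ-inj σ₂ (trans (sym z-eq) b-eq)

    walk : ∀ {w} → Reach G A w (φ σ₁ v) → At w
    walk here = at₁ here
    walk (step g Ag j p) with cover Γ g | walk p
    ... | inj₁ (e , o) | next-at with joins-unique {G} {g} j (over-joins σ₁ o)
    ...   | inj₁ (refl , refl) = at₁ (step e (in₁ o Ag) (ends-joins G₁ e) (proj₁ next-at refl))
    ...   | inj₂ (refl , refl) = at₁ (step e (in₁ o Ag) (joins-sym {G₁} (ends-joins G₁ e)) (proj₁ next-at refl))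
    walk (step g Ag j p) | inj₂ (e , o) | next-at with joins-unique {G} {g} j (over-joins σ₂ o)
    ...   | inj₁ (refl , refl) = let z₁ , z₂ , eq , q , r = proj₂ next-at refl in
            at₂ (z₁ , z₂ , eq , step e (in₂ o Ag) (ends-joins G₂ e) q , r)
    ...   | inj₂ (refl , refl) = let z₁ , z₂ , eq , q , r = proj₂ next-at refl in
            at₂ (z₁ , z₂ , eq , step e (in₂ o Ag) (joins-sym {G₂} (ends-joins G₂ e)) q , r)

  record Agree (c : Colouring G) (c₁ : Colouring G₁) (c₂ : Colouring G₂) : Set where
    field
      agree₁ : ∀ {g e} → Over σ₁ g e → c g ≡ c₁ e
      agree₂ : ∀ {g e} → Over σ₂ g e → c g ≡ c₂ e

  union : Colouring G₁ → Colouring G₂ → Colouring G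
  union c₁ c₂ g = [ (λ (e , _) → c₁ e) , (λ (e , _) → c₂ e) ]′ (cover Γ g)

  union-agree : ∀ c₁ c₂ → Agree (union c₁ c₂) c₁ c₂
  union-agree c₁ c₂ = record { agree₁ = on₁ ; agree₂ = on₂ }
    where
    on₁ : ∀ {g e} → Over σ₁ g e → union c₁ c₂ g ≡ c₁ e
    on₁ {g} o with cover Γ g
    ... | inj₁ (_ , o′) = cong c₁ (over-fun σ₁ o′ o)
    ... | inj₂ (_ , o′) = ⊥-elim (disjoint Γ o o′)

    on₂ : ∀ {g e} → Over σ₂ g e → union c₁ c₂ g ≡ c₂ e
    on₂ {g} o with cover Γ g
    ... | inj₁ (_ , o′) = ⊥-elim (disjoint Γ o′ o)
    ... | inj₂ (_ , o′) = cong c₂ (over-fun σ₂ o′ o)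

  -- Otherwise the common colour class of d₁ and d₂ would not connect their ends in G.
  opposite-colours : ∀ {c c₁ c₂} → Agree c c₁ c₂ → BiTree G c → BiTree G₁ c₁ → BiTree G₂ c₂ →
                     c₂ d₂ ≡ not (c₁ d₁)
  opposite-colours {c} {c₁} {c₂} A t t₁ t₂ = ¬-not same⇒⊥
    where
    open Agree A
    b = c₁ d₁
    same⇒⊥ : c₂ d₂ ≢ b
    same⇒⊥ eq = proj₂ (t₁ b) d₁ refl
      (project-reach {B₁ = _-ₑ_ {G₁} (Class G₁ c₁ b) d₁} {B₂ = _-ₑ_ {G₂} (Class G₂ c₂ b) d₂}
        (λ o cg → trans (sym (agree₁ o)) cg , over-≢ σ₁ o)
        (λ o cg → trans (sym (agree₂ o)) cg , over-≢ σ₂ o)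
        (λ l → contradiction l (proj₂ (t₂ b) d₂ eq))
        (proj₁ (t b) _ _))

open Agree

record Config {G G₁ G₂ : Graph} {d₁ : Edge G₁} {d₂ : Edge G₂} (σ₁ : Side G G₁ d₁) (σ₂ : Side G G₂ d₂)
              (c : Colouring G) (c₁ : Colouring G₁) (c₂ : Colouring G₂) : Set where
  field
    glued    : Glued σ₁ σ₂
    agree    : Agree glued c c₁ c₂
    tree₁    : BiTree G₁ c₁
    tree₂    : BiTree G₂ c₂
    opposite : c₂ d₂ ≡ not (c₁ d₁)

agree-sym : ∀ {G G₁ G₂ d₁ d₂} {σ₁ : Side G G₁ d₁} {σ₂ : Side G G₂ d₂} {Γ : Glued σ₁ σ₂} {c c₁ c₂} →
            Agree Γ c c₁ c₂ → Agree (glued-sym Γ) c c₂ c₁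
agree-sym A = record { agree₁ = agree₂ A ; agree₂ = agree₁ A }

config-sym : ∀ {G G₁ G₂ d₁ d₂} {σ₁ : Side G G₁ d₁} {σ₂ : Side G G₂ d₂} {c c₁ c₂} →
             Config σ₁ σ₂ c c₁ c₂ → Config σ₂ σ₁ c c₂ c₁
config-sym {c₁ = c₁} K = record
  { glued    = glued-sym glued
  ; agree    = agree-sym agree
  ; tree₁    = tree₂
  ; tree₂    = tree₁
  ; opposite = trans (sym (not-involutive _)) (cong not (sym opposite))
  }
  where open Config K

-- Fundamental cuts of the sum

module _ {G G₁ G₂ : Graph} {d₁ : Edge G₁} {d₂ : Edge G₂} {σ₁ : Side G G₁ d₁} {σ₂ : Side G G₂ d₂}
         {c : Colouring G} {c₁ : Colouring G₁} {c₂ : Colouring G₂} (K : Config σ₁ σ₂ c c₁ c₂) where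

  open Config K

  private
    class₁ : ∀ {b h h₁ g e} → Over σ₁ h h₁ → Over σ₁ g e →
             (_-ₑ_ {G₁} (Class G₁ c₁ b) h₁) e → (_-ₑ_ {G} (Class G c b) h) g
    class₁ oh o (ce , e≢h₁) = trans (agree₁ agree o) ce , λ { refl → e≢h₁ (over-fun σ₁ o oh) }

    class₂ : ∀ {b h h₁ g e} → Over σ₁ h h₁ → Over σ₂ g e →
             Class G₂ c₂ b e → (_-ₑ_ {G} (Class G c b) h) g
    class₂ oh o ce = trans (agree₂ agree o) ce , λ { refl → disjoint glued oh o }

    not-both : ∀ {b} → c₁ d₁ ≡ b → c₂ d₂ ≡ b → ⊥
    not-both p q = not-¬ (trans q (sym p)) opposite

  -- If `d₁` has colour `b`, the class of `G₂` is free of `d₂` and replaces `d₁` in walks.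
  -- Conversely, that class without `d₂` links the ends of `d₂` only if `d₁` has colour `b`.
  cut-within : ∀ {b h h₁ g g₁} → Over σ₁ h h₁ → Over σ₁ g g₁ →
               Cut G (Class G c b) h g ⇔ Cut G₁ (Class G₁ c₁ b) h₁ g₁
  cut-within {b} {h} {h₁} {g} {g₁} oh og = mk⇔
    (λ cut p → cut (reach⇒linked (over-joins σ₁ og) (lift-reach σ₁ (class₁ oh) up p)))
    (λ cut p → cut (project-reach glued
        {B₁ = _-ₑ_ {G₁} (Class G₁ c₁ b) h₁} {B₂ = _-ₑ_ {G₂} (Class G₂ c₂ b) d₂}
        (λ { o (ce , e≢h) → trans (sym (agree₁ agree o)) ce , λ { refl → e≢h (over-inj σ₁ o oh) } })
        (λ o (ce , _) → trans (sym (agree₂ agree o)) ce , over-≢ σ₂ o)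
        down
        (linked⇒reach (over-joins σ₁ og) p)))
    where
    up : ∀ {u v} → (_-ₑ_ {G₁} (Class G₁ c₁ b) h₁) d₁ → Joins G₁ d₁ u v →
         Reach G (_-ₑ_ {G} (Class G c b) h) (φ σ₁ u) (φ σ₁ v)
    up (cd₁ , _) = bridge glued λ {u} {v} _ →
      lift-reach σ₂ (class₂ oh) (λ cd₂ _ → ⊥-elim (not-both cd₁ cd₂)) (proj₁ (tree₂ b) u v)

    down : Linked G₂ (_-ₑ_ {G₂} (Class G₂ c₂ b) d₂) d₂ → (_-ₑ_ {G₁} (Class G₁ c₁ b) h₁) d₁
    down l with c₁ d₁ ≟ᵇ b
    ... | yes eq = eq , λ d₁≡h₁ → over-≢ σ₁ oh (sym d₁≡h₁)
    ... | no neq = contradiction l (proj₂ (tree₂ b) d₂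
                     (trans opposite (trans (cong not (¬-not neq)) (not-involutive b))))

  -- Without `h`, the ends of `g` are linked if the tree of `G₂` links them without `d₂`, or if `G₁`
  -- still links the glued vertices and so leaves the tree of `G₂` intact. The cut says that both
  -- fail.
  cut-across : ∀ {b h h₁ g g₂} → Over σ₁ h h₁ → Over σ₂ g g₂ →
               Cut G (Class G c b) h g ⇔ (Cut G₁ (Class G₁ c₁ b) h₁ d₁ × Cut G₂ (Class G₂ c₂ b) d₂ g₂)
  cut-across {b} {h} {h₁} {g} {g₂} oh og = mk⇔
    (λ cut → (λ p → cut (via-G₁ p)) ,
             (λ p → cut (reach⇒linked (over-joins σ₂ og)
                      (lift-reach σ₂ (λ o (ce , _) → class₂ oh o ce) (λ (_ , d≢d) _ → contradiction refl d≢d) p))))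
    (λ (cut₁ , cut₂) p → cut₂ (project-reach (glued-sym glued)
        {B₁ = _-ₑ_ {G₂} (Class G₂ c₂ b) d₂} {B₂ = _-ₑ_ {G₁} (Class G₁ c₁ b) h₁}
        (λ o (ce , _) → trans (sym (agree₂ agree o)) ce , over-≢ σ₂ o)
        (λ { o (ce , e≢h) → trans (sym (agree₁ agree o)) ce , λ { refl → e≢h (over-inj σ₁ o oh) } })
        (λ l → contradiction l cut₁)
        (linked⇒reach (over-joins σ₂ og) p)))
    where
    via-G₁ : Linked G₁ (_-ₑ_ {G₁} (Class G₁ c₁ b) h₁) d₁ → Linked G (_-ₑ_ {G} (Class G c b) h) g
    via-G₁ l = reach⇒linked (over-joins σ₂ og)
      (lift-reach σ₂ (class₂ oh)
        (λ cd₂ → bridge (glued-sym glued) λ j →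
          lift-reach σ₁ (class₁ oh) (λ (cd₁ , _) _ → ⊥-elim (not-both cd₁ cd₂)) (linked⇒reach j l))
        (proj₁ (tree₂ b) _ _))

-- Transfer of exchanges to the sum

module _ {G G₁ G₂ : Graph} {d₁ : Edge G₁} {d₂ : Edge G₂} {σ₁ : Side G G₁ d₁} {σ₂ : Side G G₂ d₂}
         {c : Colouring G} {c₁ : Colouring G₁} {c₂ : Colouring G₂} (K : Config σ₁ σ₂ c c₁ c₂) where

  open Config K

  private
    K′ = config-sym K

  exchange-lift : ∀ {b e f e₁ f₁} → Over σ₁ e e₁ → Over σ₁ f f₁ →
                  Exchange G₁ c₁ b e₁ f₁ → Exchange G c b e f
  exchange-lift {b} {e} {f} {e₁} {f₁} oe of x = record
    { colour-e = trans (agree₁ agree oe) (colour-e x)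
    ; colour-f = trans (agree₁ agree of) (colour-f x)
    ; cut-e    = from (cut-within K oe of) (cut-e x)
    ; cut-f    = from (cut-within K of oe) (cut-f x)
    ; unique   = uniq
    }
    where
    uniq : ∀ g → c g ≡ not b → Cut G (Class G c b) e g → Cut G (Class G c (not b)) g e → g ≡ f
    uniq g cg cut cut′ with cover glued g
    ... | inj₁ (g₁ , og) with unique x g₁ (trans (sym (agree₁ agree og)) cg)
                                (to (cut-within K oe og) cut) (to (cut-within K og oe) cut′)
    ...   | refl = over-inj σ₁ og of
    -- A competitor in `G₂` would turn `d₁` into a competitor of `f₁` in `G₁`.
    uniq g cg cut cut′ | inj₂ (g₂ , og) =
      contradiction (unique x d₁ (¬-not cd₁≢b) cut-d₁ (proj₂ (to (cut-across K′ og oe) cut′)))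
                    (λ d₁≡f₁ → over-≢ σ₁ of (sym d₁≡f₁))
      where
      cut-d₁ : Cut G₁ (Class G₁ c₁ b) e₁ d₁
      cut-d₁ = proj₁ (to (cut-across K oe og) cut)

      cd₁≢b : c₁ d₁ ≢ b
      cd₁≢b eq = cut-d₁ (edge (eq , λ d₁≡e₁ → over-≢ σ₁ oe (sym d₁≡e₁)) (ends-joins G₁ d₁))

  -- A competitor of `p` lying in `G₁` competes with `p₁` for `d₁`, hence is `p`; one lying in `G₂`
  -- competes with `d₂` for `q₂`, hence would be a copy of `d₂`, which does not exist.
  exchange-merge : ∀ {b p q p₁ q₂} → Over σ₁ p p₁ → Over σ₂ q q₂ →
                   Exchange G₁ c₁ b d₁ p₁ → Exchange G₂ c₂ b q₂ d₂ → Exchange G c b q p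
  exchange-merge {b} {p} {q} {p₁} {q₂} op oq x y = record
    { colour-e = trans (agree₂ agree oq) (colour-e y)
    ; colour-f = trans (agree₁ agree op) (colour-f x)
    ; cut-e    = from (cut-across K′ oq op) (cut-e y , cut-e x)
    ; cut-f    = from (cut-across K op oq) (cut-f x , cut-f y)
    ; unique   = uniq
    }
    where
    uniq : ∀ g → c g ≡ not b → Cut G (Class G c b) q g → Cut G (Class G c (not b)) g q → g ≡ p
    uniq g cg cut cut′ with cover glued g
    ... | inj₁ (g₁ , og) with unique x g₁ (trans (sym (agree₁ agree og)) cg)
                                (proj₂ (to (cut-across K′ oq og) cut)) (proj₁ (to (cut-across K og oq) cut′))
    ...   | refl = over-inj σ₁ og op
    uniq g cg cut cut′ | inj₂ (g₂ , og) =
      contradiction (unique y g₂ (trans (sym (agree₂ agree og)) cg)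
                      (to (cut-within K′ oq og) cut) (to (cut-within K′ og oq) cut′))
                    (over-≢ σ₂ og)

  step-lift : ∀ {c₀ : Colouring G} {c₁₀ c₁′ c′} →
              (∀ {g e} → Over σ₁ g e → c₀ g ≡ c₁₀ e) → Agree glued c′ c₁′ c₂ →
              Step G₁ c₁₀ (Other {G₁} d₁) c₁ c₁′ → Step G c₀ (Always {G}) c c′
  step-lift {c₁′ = c₁′} {c′} agree₀ agree′ s = record
    { exchange = exchange-lift oe of exchange
    ; flip     = record
      { flip-e = trans (agree₁ agree′ oe) (trans (flip-e flip) (cong not (sym (agree₁ agree oe))))
      ; flip-f = trans (agree₁ agree′ of) (trans (flip-f flip) (cong not (sym (agree₁ agree of))))
      ; keep   = kept
      }
    ; fresh-e  = trans (agree₁ agree oe) (trans fresh-e (sym (agree₀ oe)))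
    ; fresh-f  = trans (agree₁ agree of) (trans fresh-f (sym (agree₀ of)))
    ; ok-e     = tt
    ; ok-f     = tt
    }
    where
    open Step s
    oe = proj₂ (lift σ₁ ok-e)
    of = proj₂ (lift σ₁ ok-f)

    kept : ∀ {g} → g ≢ proj₁ (lift σ₁ ok-e) → g ≢ proj₁ (lift σ₁ ok-f) → c′ g ≡ c g
    kept {g} g≢e g≢f with cover glued g
    ... | inj₁ (g₁ , og) = trans (agree₁ agree′ og)
            (trans (keep flip (λ { refl → g≢e (over-inj σ₁ og oe) }) (λ { refl → g≢f (over-inj σ₁ og of) }))
                   (sym (agree₁ agree og)))
    ... | inj₂ (g₂ , og) = trans (agree₂ agree′ og) (sym (agree₂ agree og))

  step-merge : ∀ {c₀ : Colouring G} {c₁₀ c₂₀ c₁′ c₂′ c′} →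
               Agree glued c₀ c₁₀ c₂₀ → Agree glued c′ c₁′ c₂′ →
               (s₁ : Step G₁ c₁₀ (Always {G₁}) c₁ c₁′) → Leads {G₁} d₁ (Step.e s₁) (Step.f s₁) →
               (s₂ : Step G₂ c₂₀ (Always {G₂}) c₂ c₂′) → Follows {G₂} d₂ (Step.e s₂) (Step.f s₂) →
               Step G c₀ (Always {G}) c c′
  step-merge {c₁′ = c₁′} {c₂′} {c′} agree₀ agree′ s₁ refl s₂ refl = record
    { exchange = exchange-merge op oq s₁.exchange
                   (subst (λ b → Exchange G₂ c₂ b s₂.e s₂.f) same-b s₂.exchange)
    ; flip     = record
      { flip-e = trans (agree₂ agree′ oq) (trans (flip-e s₂.flip) (cong not (sym (agree₂ agree oq))))
      ; flip-f = trans (agree₁ agree′ op) (trans (flip-f s₁.flip) (cong not (sym (agree₁ agree op))))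
      ; keep   = kept
      }
    ; fresh-e  = trans (agree₂ agree oq) (trans s₂.fresh-e (sym (agree₂ agree₀ oq)))
    ; fresh-f  = trans (agree₁ agree op) (trans s₁.fresh-f (sym (agree₁ agree₀ op)))
    ; ok-e     = tt
    ; ok-f     = tt
    }
    where
    module s₁ = Step s₁
    module s₂ = Step s₂

    p≢d₁ : s₁.f ≢ d₁
    p≢d₁ eq = not-¬ (colour-e s₁.exchange) (trans (cong c₁ (sym eq)) (colour-f s₁.exchange))

    q≢d₂ : s₂.e ≢ d₂
    q≢d₂ eq = not-¬ (colour-e s₂.exchange) (trans (cong c₂ eq) (colour-f s₂.exchange))

    op = proj₂ (lift σ₁ p≢d₁)
    oq = proj₂ (lift σ₂ q≢d₂)

    -- `d₁` has colour `s₁.b` and `d₂`, being second in its pair, has colour `not s₂.b`; `opposite`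
    -- then equates the two.
    same-b : s₂.b ≡ s₁.b
    same-b = trans (not-injective (trans (sym (colour-f s₂.exchange)) opposite)) (colour-e s₁.exchange)

    kept : ∀ {g} → g ≢ proj₁ (lift σ₂ q≢d₂) → g ≢ proj₁ (lift σ₁ p≢d₁) → c′ g ≡ c g
    kept {g} g≢q g≢p with cover glued g
    ... | inj₁ (g₁ , og) = trans (agree₁ agree′ og)
            (trans (keep s₁.flip (over-≢ σ₁ og) (λ { refl → g≢p (over-inj σ₁ og op) }))
                   (sym (agree₁ agree og)))
    ... | inj₂ (g₂ , og) = trans (agree₂ agree′ og)
            (trans (keep s₂.flip (λ { refl → g≢q (over-inj σ₂ og oq) }) (over-≢ σ₂ og))
                   (sym (agree₂ agree og)))

-- The run avoids `d₁` and leaves `G₂` untouched, so the join colours stay opposite at every step.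
run-lift : ∀ {G G₁ G₂ d₁ d₂} {σ₁ : Side G G₁ d₁} {σ₂ : Side G G₂ d₂} {c₀ : Colouring G} {c₁₀ n c c₁ c₁′ c₂} →
           (∀ {g e} → Over σ₁ g e → c₀ g ≡ c₁₀ e) → Config σ₁ σ₂ c c₁ c₂ →
           Run G₁ c₁₀ (Other {G₁} d₁) n c₁ c₁′ →
           ∃ λ c′ → Config σ₁ σ₂ c′ c₁′ c₂ × Run G c₀ (Always {G}) n c c′
run-lift agree₀ K done = _ , K , done
run-lift {d₁ = d₁} {d₂} {σ₁} {σ₂} {c₂ = c₂} agree₀ K (next {c′ = c₁′} s r) =
  let c″ , K″ , r″ = run-lift agree₀ K′ r in
  c″ , K″ , next (step-lift K agree₀ (union-agree glued c₁′ c₂) s) r″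
  where
  open Config K
  K′ : Config σ₁ σ₂ (union glued c₁′ c₂) c₁′ c₂
  K′ = record
    { glued    = glued
    ; agree    = union-agree glued c₁′ c₂
    ; tree₁    = step-biTree s tree₁
    ; tree₂    = tree₂
    ; opposite = trans opposite (cong not (sym (keep (Step.flip s)
                   (λ d₁≡e → Step.ok-e s (sym d₁≡e)) (λ d₁≡f → Step.ok-f s (sym d₁≡f)))))
    }

ordering-merge : ∀ {G G₁ G₂ d₁ d₂} {σ₁ : Side G G₁ d₁} {σ₂ : Side G G₂ d₂} {c₀ : Colouring G} {c₁₀ c₂₀} →
                 Config σ₁ σ₂ c₀ c₁₀ c₂₀ →
                 Passage G₁ c₁₀ (Leads {G₁} d₁) d₁ → Passage G₂ c₂₀ (Follows {G₂} d₂) d₂ → Ordering G c₀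
ordering-merge {G} {d₁ = d₁} {d₂} {σ₁} {σ₂} {c₀} {c₁₀} {c₂₀} K π₁ π₂ =
  let cᵃ , Kᵃ , rᵃ = run-lift (agree₁ agree) K₀ π₁.before
      cᵇ , Kᵇ , rᵇ = run-lift (agree₂ agree) (config-sym Kᵃ) π₂.before
      Γ            = Config.glued (config-sym Kᵇ)
      cᶜ           = union Γ π₁.c₂ π₂.c₂
      s            = step-merge (config-sym Kᵇ) {c₀ = c₀} {c₁₀} {c₂₀} {c′ = cᶜ} (agree-any Γ) (union-agree Γ π₁.c₂ π₂.c₂)
                       π₁.crossing π₁.meets π₂.crossing π₂.meets
      Kᶜ           = merged (config-sym Kᵇ)
      cᵈ , Kᵈ , rᵈ = run-lift (agree₁ agree) Kᶜ π₁.after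
      cᵉ , Kᵉ , rᵉ = run-lift (agree₂ agree) (config-sym Kᵈ) π₂.after
  in record
    { run   = (rᵃ +++ rᵇ) +++ next s (rᵈ +++ rᵉ)
    ; start = start
    ; end   = end (config-sym Kᵉ)
    }
  where
  open Config K
  module π₁ = Passage π₁
  module π₂ = Passage π₂

  agree-any : (Γ : Glued σ₁ σ₂) → Agree Γ c₀ c₁₀ c₂₀
  agree-any _ = record { agree₁ = agree₁ agree ; agree₂ = agree₂ agree }

  c = union glued π₁.c π₂.c

  K₀ : Config σ₁ σ₂ c π₁.c π₂.c
  K₀ = record
    { glued    = glued
    ; agree    = union-agree glued π₁.c π₂.c
    ; tree₁    = biTree-resp (λ g → sym (π₁.start g)) tree₁
    ; tree₂    = biTree-resp (λ g → sym (π₂.start g)) tree₂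
    ; opposite = trans (π₂.start d₂) (trans opposite (cong not (sym (π₁.start d₁))))
    }

  merged : ∀ {cᵇ} (Kᵇ : Config σ₁ σ₂ cᵇ π₁.c₁ π₂.c₁) →
           Config σ₁ σ₂ (union (Config.glued Kᵇ) π₁.c₂ π₂.c₂) π₁.c₂ π₂.c₂
  merged Kᵇ = record
    { glued    = Config.glued Kᵇ
    ; agree    = union-agree (Config.glued Kᵇ) π₁.c₂ π₂.c₂
    ; tree₁    = step-biTree π₁.crossing (Config.tree₁ Kᵇ)
    ; tree₂    = step-biTree π₂.crossing (Config.tree₂ Kᵇ)
    -- Both join edges flip in the merged step, so their colours remain opposite.
    ; opposite = trans d₂-flips (trans (cong not (Config.opposite Kᵇ)) (cong not (sym d₁-flips)))
    }
    where
    d₁-flips : π₁.c₂ d₁ ≡ not (π₁.c₁ d₁)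
    d₁-flips = subst (λ d → π₁.c₂ d ≡ not (π₁.c₁ d)) π₁.meets (flip-e (Step.flip π₁.crossing))
    d₂-flips : π₂.c₂ d₂ ≡ not (π₂.c₁ d₂)
    d₂-flips = subst (λ d → π₂.c₂ d ≡ not (π₂.c₁ d)) π₂.meets (flip-f (Step.flip π₂.crossing))

  start : c ≗ c₀
  start g with cover glued g
  ... | inj₁ (e , o) = trans (π₁.start e) (sym (agree₁ agree o))
  ... | inj₂ (e , o) = trans (π₂.start e) (sym (agree₂ agree o))

  end : ∀ {c′} → Config σ₁ σ₂ c′ π₁.c′ π₂.c′ → c′ ≗ not ∘ c₀
  end K′ g with cover glued g
  ... | inj₁ (e , o) = trans (agree₁ (Config.agree K′) o) (trans (π₁.end e) (cong not (sym (agree₁ agree o))))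
  ... | inj₂ (e , o) = trans (agree₂ (Config.agree K′) o) (trans (π₂.end e) (cong not (sym (agree₂ agree o))))

ordering-sum : ∀ {G G₁ G₂ d₁ d₂} {σ₁ : Side G G₁ d₁} {σ₂ : Side G G₂ d₂} {c₀ : Colouring G} {c₁₀ c₂₀} →
               Config σ₁ σ₂ c₀ c₁₀ c₂₀ → Ordering G₁ c₁₀ → Ordering G₂ c₂₀ → Ordering G c₀
ordering-sum {d₁ = d₁} {d₂} K o₁ o₂ with passage d₁ o₁ | passage d₂ o₂
... | inj₁ π₁ | inj₂ π₂ = ordering-merge K π₁ π₂
... | inj₂ π₁ | inj₁ π₂ = ordering-merge (config-sym K) π₂ π₁
-- `Leads d e f` and `Follows d f e` unfold to the same equation, hence `id`.
... | inj₁ π₁ | inj₁ π₂ = ordering-merge K π₁ (passage-reverse id (Config.tree₂ K) π₂)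
... | inj₂ π₁ | inj₂ π₂ = ordering-merge (config-sym K) (passage-reverse id (Config.tree₂ K) π₂) π₁

-- Exchange sequences versus cyclic base orderings

-- Translating a unique exchange needs the current classes to be trees, which the preceding
-- exchanges guarantee; hence the tree argument of each step.
build-run : ∀ {c₀ : Colouring G} n (k : ℕ → Colouring G) →
            (∀ (i : Fin n) → BiTree G (k (toℕ i)) → Step G c₀ (Always {G}) (k (toℕ i)) (k (suc (toℕ i)))) →
            BiTree G (k 0) → Run G c₀ (Always {G}) n (k 0) (k n)
build-run zero    k s t = done
build-run (suc n) k s t = next (s zero t) (build-run n (k ∘ suc) (s ∘ suc) (step-biTree (s zero t) t))

uecbo⇒ordering : ∀ {S T : EdgeSet G} {c₀ : Colouring G} →
                 (∀ {g} → S g ⇔ c₀ g ≡ true) → (∀ {g} → T g ⇔ c₀ g ≡ false) →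
                 BiTree G c₀ → HasUECBO G S T → Ordering G c₀
uecbo⇒ordering {G} {c₀ = c₀} S⇔ T⇔ tree (seq , s , t , s-inj , t-inj , S-enum , T-enum , cond) = record
  { run   = build-run m k stepAt (biTree-resp (λ g → sym (k-late {0} {g} λ ())) tree)
  ; start = λ g → k-late {0} {g} λ ()
  ; end   = λ g → k-early {m} {g} (toℕ<n (pos g))
  }
  where
  m = half G

  pk : Bool → Fin m → Edge G
  pk true  = s
  pk false = t

  pk-colour : ∀ b i → c₀ (pk b i) ≡ b
  pk-colour true  i = to S⇔ (from (S-enum _) (i , refl))
  pk-colour false i = to T⇔ (from (T-enum _) (i , refl))

  pk-inj : ∀ b → Injective _≡_ _≡_ (pk b)
  pk-inj true  = s-inj
  pk-inj false = t-inj

  index : ∀ g → ∃ λ i → pk (c₀ g) i ≡ g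
  index g with c₀ g in eq
  ... | true  = to (S-enum g) (from S⇔ eq)
  ... | false = to (T-enum g) (from T⇔ eq)

  pos : Edge G → Fin m
  pos g = proj₁ (index g)

  pos-pk : ∀ b i → pos (pk b i) ≡ i
  pos-pk b i = pk-inj b (trans (cong (λ b′ → pk b′ (pos (pk b i))) (sym (pk-colour b i))) (proj₂ (index (pk b i))))

  -- The pair (X, Y) at time `j` as a colouring: exactly the edges at positions below `j` have
  -- changed sides.
  k : ℕ → Colouring G
  k j g with toℕ (pos g) ℕ.<? j
  ... | yes _ = not (c₀ g)
  ... | no _  = c₀ g

  k-early : ∀ {j g} → toℕ (pos g) ℕ.< j → k j g ≡ not (c₀ g)
  k-early {j} {g} lt with toℕ (pos g) ℕ.<? j
  ... | yes _  = refl
  ... | no ≮j = contradiction lt ≮j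

  k-late : ∀ {j g} → ¬ toℕ (pos g) ℕ.< j → k j g ≡ c₀ g
  k-late {j} {g} ≮j with toℕ (pos g) ℕ.<? j
  ... | yes lt = contradiction lt ≮j
  ... | no _   = refl

  X : Bool → Fin m → EdgeSet G
  X b = Xᵢ G (pk b) (pk (not b))

  X⇔ : ∀ b i {g} → X b i g ⇔ k (toℕ i) g ≡ b
  X⇔ b i {g} = mk⇔ there back
    where
    there : X b i g → k (toℕ i) g ≡ b
    there (inj₁ (j , i≤j , refl)) =
      trans (k-late {toℕ i} {pk b j} (ℕₚ.≤⇒≯ (subst (i ≤_) (sym (pos-pk b j)) i≤j))) (pk-colour b j)
    there (inj₂ (j , j<i , refl)) =
      trans (k-early {toℕ i} {pk (not b) j} (subst (_< i) (sym (pos-pk (not b) j)) j<i))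
            (trans (cong not (pk-colour (not b) j)) (not-involutive b))

    back : k (toℕ i) g ≡ b → X b i g
    back kg with toℕ (pos g) ℕ.<? toℕ i
    ... | yes lt = inj₂ (pos g , lt , trans (cong (λ b′ → pk b′ (pos g)) (trans (cong not (sym kg)) (not-involutive _))) (proj₂ (index g)))
    ... | no ≮i  = inj₁ (pos g , ℕₚ.≮⇒≥ ≮i , trans (cong (λ b′ → pk b′ (pos g)) (sym kg)) (proj₂ (index g)))

  -- `b` encodes the order within the pair and `b′` whether it is an X or a Y exchange; kept apart,
  -- they cover all four cases of the definition at once.
  make-step : ∀ b b′ i → BiTree G (k (toℕ i)) →
              UniqueExch G (X b′ i) (X (not b′) i) (pk b i) (pk (not b) i) →
              Step G c₀ (Always {G}) (k (toℕ i)) (k (suc (toℕ i)))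
  make-step b b′ i t u = record
    { exchange = uniqueExch⇒exchange t (uniqueExch-resp (X⇔ b′ i) (X⇔ (not b′) i) u)
    ; flip     = record { flip-e = flips b ; flip-f = flips (not b) ; keep = kept }
    ; fresh-e  = before b
    ; fresh-f  = before (not b)
    ; ok-e     = tt
    ; ok-f     = tt
    }
    where
    before : ∀ b → k (toℕ i) (pk b i) ≡ c₀ (pk b i)
    before b = k-late {toℕ i} {pk b i} (λ lt → ℕₚ.<⇒≢ lt (cong toℕ (pos-pk b i)))

    flips : ∀ b → k (suc (toℕ i)) (pk b i) ≡ not (k (toℕ i) (pk b i))
    flips b = trans (k-early {suc (toℕ i)} {pk b i} (s≤s (ℕₚ.≤-reflexive (cong toℕ (pos-pk b i)))))
                    (cong not (sym (before b)))

    kept : ∀ {g} → g ≢ pk b i → g ≢ pk (not b) i → k (suc (toℕ i)) g ≡ k (toℕ i) g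
    kept {g} g≢₁ g≢₂ with toℕ (pos g) ℕ.<? toℕ i
    ... | yes lt = k-early {suc (toℕ i)} {g} (ℕₚ.m<n⇒m<1+n lt)
    -- A change between times `i` and `i + 1` would put `g` at position `i`, which only the two
    -- exchanged edges occupy.
    ... | no ≮i  = k-late {suc (toℕ i)} {g} (λ lt → pos≢i (toℕ-injective (ℕₚ.≤-antisym (ℕ.s≤s⁻¹ lt) (ℕₚ.≮⇒≥ ≮i))))
      where
      pos≢i : pos g ≢ i
      pos≢i refl with c₀ g ≟ᵇ b
      ... | yes refl = g≢₁ (sym (proj₂ (index g)))
      ... | no neq   = g≢₂ (trans (sym (proj₂ (index g))) (cong (λ b′ → pk b′ (pos g)) (¬-not neq)))

  stepAt : ∀ i → BiTree G (k (toℕ i)) → Step G c₀ (Always {G}) (k (toℕ i)) (k (suc (toℕ i)))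
  stepAt i t with seq i | cond i
  ... | _ | inj₁ refl , inj₁ u = make-step true true i t u
  ... | _ | inj₁ refl , inj₂ u = make-step true false i t u
  ... | _ | inj₂ refl , inj₁ u = make-step false true i t u
  ... | _ | inj₂ refl , inj₂ u = make-step false false i t u

-- From runs back to cyclic base orderings

module _ {G : Graph} {c₀ : Colouring G} where

  private
    R = Run G c₀ (Always {G})

  stepAt : ∀ {n c c′} → R n c c′ → Fin n → ∃ λ c₁ → ∃ λ c₂ → Step G c₀ (Always {G}) c₁ c₂
  stepAt (next s r) zero    = _ , _ , s
  stepAt (next s r) (suc i) = stepAt r i

  colouringAt : ∀ {n c c′} → R n c c′ → Fin n → Colouring G
  colouringAt r i = proj₁ (stepAt r i)

  pickAt : ∀ {n c c′} → R n c c′ → Bool → Fin n → Edge G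
  pickAt r b i = pick (proj₂ (proj₂ (stepAt r i))) b

  pickAt-colour : ∀ {n c c′} (r : R n c c′) b i → c₀ (pickAt r b i) ≡ b
  pickAt-colour r b i = pick-colour (proj₂ (proj₂ (stepAt r i))) b

  colouringAt-biTree : ∀ {n c c′} (r : R n c c′) → BiTree G c → ∀ i → BiTree G (colouringAt r i)
  colouringAt-biTree (next s r) t zero    = t
  colouringAt-biTree (next s r) t (suc i) = colouringAt-biTree r (step-biTree s t) i

  pickAt-initial : ∀ {n c c′} (r : R n c c′) b i → c (pickAt r b i) ≡ b
  pickAt-initial (next s r) b zero    = pick-before s b
  pickAt-initial (next s r) b (suc i) =
    trans (step-unsettled s (trans (pickAt-initial r b i) (sym (pickAt-colour r b i)))) (pickAt-colour r b i)

  settled : ∀ {n c c′} (r : R n c c′) {g} → c g ≡ not (c₀ g) → ∀ j → colouringAt r j g ≡ not (c₀ g)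
  settled (next s r) cg zero    = cg
  settled (next s r) cg (suc j) = settled r (step-settled s cg) j

  pickAt-until : ∀ {n c c′} (r : R n c c′) b {i j} → j ≤ i → colouringAt r j (pickAt r b i) ≡ b
  pickAt-until r@(next _ _) b {i} {zero} _ = pickAt-initial r b i
  pickAt-until (next _ r) b {suc i} {suc j} (s≤s j≤i) = pickAt-until r b j≤i

  pickAt-after : ∀ {n c c′} (r : R n c c′) b {i j} → i < j → colouringAt r j (pickAt r b i) ≡ not b
  pickAt-after (next s r) b {zero} {suc j} _ =
    trans (settled r (trans (pick-after s b) (cong not (sym (pick-colour s b)))) j) (cong not (pick-colour s b))
  pickAt-after (next _ r) b {suc i} {suc j} (s≤s i<j) = pickAt-after r b i<j

  pickAt-surjective : ∀ {n c c′} (r : R n c c′) {g} → c g ≡ c₀ g → c′ g ≡ not (c₀ g) →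
                      ∃ λ i → pickAt r (c₀ g) i ≡ g
  pickAt-surjective done cg c′g = contradiction c′g (not-¬ cg)
  pickAt-surjective (next s r) {g} cg c′g with picked? s g
  ... | inj₁ eq = zero , eq
  ... | inj₂ eq = let i , p = pickAt-surjective r (trans eq cg) c′g in suc i , p

  -- An edge picked twice would, at the later time, have both its initial colour, being picked, and
  -- the opposite one, having flipped.
  pickAt-injective : ∀ {n c c′} (r : R n c c′) b → Injective _≡_ _≡_ (pickAt r b)
  pickAt-injective r b {i} {j} eq with <-cmp i j
  ... | tri≈ _ i≡j _ = i≡j
  ... | tri< i<j _ _ = contradiction (trans (cong (colouringAt r j) (sym eq)) (pickAt-after r b i<j))
                                     (not-¬ (pickAt-until r b {j} ℕₚ.≤-refl))
  ... | tri> _ _ j<i = contradiction (trans (cong (colouringAt r i) eq) (pickAt-after r b j<i))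
                                     (not-¬ (pickAt-until r b {i} ℕₚ.≤-refl))

  module _ {n : ℕ} {c c′ : Colouring G} (r : R n c c′) (start : c ≗ c₀) (end : c′ ≗ not ∘ c₀) where

    private
      index : ∀ g → ∃ λ i → pickAt r (c₀ g) i ≡ g
      index g = pickAt-surjective r (start g) (end g)

      index-pickAt : ∀ b i → proj₁ (index (pickAt r b i)) ≡ i
      index-pickAt b i = pickAt-injective r b
        (trans (cong (λ b′ → pickAt r b′ (proj₁ (index (pickAt r b i)))) (sym (pickAt-colour r b i))) (proj₂ (index (pickAt r b i))))

    -- An edge is determined by the step that picks it and by its colour, so there are `n * 2`
    -- edges.
    run-length : n ≡ half G
    run-length = sym (trans (cong (_/ 2) nE≡n*2) (m*n/n≡m n 2))
      where
      edges : Edge G ↔ (Fin n × Bool)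
      edges = mk↔ₛ′ (λ g → proj₁ (index g) , c₀ g) (λ (i , b) → pickAt r b i)
        (λ (i , b) → cong₂ _,_ (index-pickAt b i) (pickAt-colour r b i)) (λ g → proj₂ (index g))

      nE≡n*2 : nE G ≡ n ℕ.* 2
      nE≡n*2 = ↔⇒≡ ((↔-sym *↔× ↔-∘ (↔-id (Fin n) ×-↔ ↔-sym 2↔Bool)) ↔-∘ edges)

    class-indices : ∀ {b g} → c₀ g ≡ b ⇔ (∃ λ i → pickAt r b i ≡ g)
    class-indices {b} {g} = mk⇔ (λ { refl → index g }) (λ { (i , refl) → pickAt-colour r b i })

    -- Xᵢ of Defs, with its index type Fin (half G) generalised to Fin n.
    Mixed : Bool → Fin n → EdgeSet G
    Mixed b i g = (∃ λ j → i ≤ j × pickAt r b j ≡ g) ⊎ (∃ λ j → j < i × pickAt r (not b) j ≡ g)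

    class⇔mixed : ∀ b i {g} → colouringAt r i g ≡ b ⇔ Mixed b i g
    class⇔mixed b i {g} = mk⇔ there back
      where
      there : colouringAt r i g ≡ b → Mixed b i g
      there cg with index g
      ... | j , eq with ℕₚ.≤-<-connex (toℕ i) (toℕ j)
      ...   | inj₁ i≤j = inj₁ (j , i≤j , trans (cong (λ b′ → pickAt r b′ j) b≡) eq)
        where
        b≡ : b ≡ c₀ g
        b≡ = trans (sym cg) (trans (cong (colouringAt r i) (sym eq)) (pickAt-until r (c₀ g) i≤j))
      ...   | inj₂ j<i = inj₂ (j , j<i , trans (cong (λ b′ → pickAt r b′ j) b≡) eq)
        where
        b≡ : not b ≡ c₀ g
        b≡ = trans (cong not (trans (sym cg) (trans (cong (colouringAt r i) (sym eq)) (pickAt-after r (c₀ g) j<i))))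
                   (not-involutive _)

      back : Mixed b i g → colouringAt r i g ≡ b
      back (inj₁ (j , i≤j , refl)) = pickAt-until r b i≤j
      back (inj₂ (j , j<i , refl)) = trans (pickAt-after r (not b) j<i) (not-involutive b)

    pairAt : Fin n → Edge G × Edge G
    pairAt i = Step.e s , Step.f s
      where s = proj₂ (proj₂ (stepAt r i))

    pairAt-exchange : BiTree G c → ∀ i →
      (pairAt i ≡ (pickAt r true i , pickAt r false i) ⊎ pairAt i ≡ (pickAt r false i , pickAt r true i)) ×
      (UniqueExch G (Mixed true i) (Mixed false i) (proj₁ (pairAt i)) (proj₂ (pairAt i)) ⊎
       UniqueExch G (Mixed false i) (Mixed true i) (proj₁ (pairAt i)) (proj₂ (pairAt i)))
    pairAt-exchange t i = oriented b (pick-b s) (pick-not-b s)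
        (uniqueExch-resp (class⇔mixed b i) (class⇔mixed (not b) i)
          (exchange⇒uniqueExch (colouringAt-biTree r t i) exchange))
      where
      s = proj₂ (proj₂ (stepAt r i))
      open Step s
      oriented : ∀ b → pickAt r b i ≡ e → pickAt r (not b) i ≡ f →
                 UniqueExch G (Mixed b i) (Mixed (not b) i) e f →
                 ((e , f) ≡ (pickAt r true i , pickAt r false i) ⊎ (e , f) ≡ (pickAt r false i , pickAt r true i)) ×
                 (UniqueExch G (Mixed true i) (Mixed false i) e f ⊎ UniqueExch G (Mixed false i) (Mixed true i) e f)
      oriented true  p q u = inj₁ (sym (cong₂ _,_ p q)) , inj₁ u
      oriented false p q u = inj₂ (sym (cong₂ _,_ p q)) , inj₂ u

ordering⇒uecbo : ∀ {S T : EdgeSet G} {c₀ : Colouring G} →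
                 (∀ {g} → S g ⇔ c₀ g ≡ true) → (∀ {g} → T g ⇔ c₀ g ≡ false) →
                 BiTree G c₀ → Ordering G c₀ → HasUECBO G S T
ordering⇒uecbo {G} {S} {T} {c₀} S⇔ T⇔ tree o = conclude run start end (run-length run start end)
  where
  open Ordering o
  -- The length becomes a variable here, so that matching on `refl` can turn it into `half G`.
  conclude : ∀ {n c c′} (r : Run G c₀ (Always {G}) n c c′) → c ≗ c₀ → c′ ≗ not ∘ c₀ →
             n ≡ half G → HasUECBO G S T
  conclude r start end refl =
    pairAt r start end , pickAt r true , pickAt r false ,
    pickAt-injective r true , pickAt-injective r false ,
    (λ g → class-indices r start end ⇔-∘ S⇔) , (λ g → class-indices r start end ⇔-∘ T⇔) ,
    pairAt-exchange r start end (biTree-resp (λ g → sym (start g)) tree)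

-- Membership in S is an arbitrary predicate; the covering condition decides it, and disjointness
-- makes the chosen side the only possible one.
bispanning-colouring : ∀ {S T : EdgeSet G} → IsBispanningPair G S T →
                       ∃ λ c → (∀ {g} → S g ⇔ c g ≡ true) × (∀ {g} → T g ⇔ c g ≡ false)
bispanning-colouring {G} {S} {T} (_ , _ , cov , disj) = c , mk⇔ S⇒ S⇐ , mk⇔ T⇒ T⇐
  where
  c : Colouring G
  c g = [ (λ _ → true) , (λ _ → false) ]′ (cov g)

  S⇒ : ∀ {g} → S g → c g ≡ true
  S⇒ {g} Sg with cov g
  ... | inj₁ _  = refl
  ... | inj₂ Tg = contradiction (Sg , Tg) (disj g)

  S⇐ : ∀ {g} → c g ≡ true → S g
  S⇐ {g} _ with cov g
  S⇐ {g} _  | inj₁ Sg = Sg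
  S⇐ {g} () | inj₂ _

  T⇒ : ∀ {g} → T g → c g ≡ false
  T⇒ {g} Tg with cov g
  ... | inj₁ Sg = contradiction (Sg , Tg) (disj g)
  ... | inj₂ _  = refl

  T⇐ : ∀ {g} → c g ≡ false → T g
  T⇐ {g} _ with cov g
  T⇐ {g} () | inj₁ _
  T⇐ {g} _  | inj₂ Tg = Tg

bispanning-biTree : ∀ {S T : EdgeSet G} {c : Colouring G} →
                    (∀ {g} → S g ⇔ c g ≡ true) → (∀ {g} → T g ⇔ c g ≡ false) →
                    IsBispanningPair G S T → BiTree G c
bispanning-biTree S⇔ T⇔ (S-tree , T-tree , _) true  = spanningTree⇒tree S⇔ S-tree
bispanning-biTree S⇔ T⇔ (S-tree , T-tree , _) false = spanningTree⇒tree T⇔ T-tree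

-- The two sides of a given 2-clique sum

module _ {G G₁ G₂ : Graph} {d₁ : Edge G₁} {d₂ : Edge G₂} (σ : TwoCliqueSum G G₁ G₂ d₁ d₂) where

  open TwoCliqueSum σ
  open Inverse ψ using (strictlyInverseˡ; strictlyInverseʳ) renaming (to to ψ⇒; from to ψ⇐)

  private
    ψ-inj : ∀ {g g′} → ψ⇒ g ≡ ψ⇒ g′ → g ≡ g′
    ψ-inj {g} {g′} eq = trans (sym (strictlyInverseʳ g)) (trans (cong ψ⇐ eq) (strictlyInverseʳ g′))

  -- over-inj relies on all proofs of e ≢ d being definitionally equal.
  side₁ : Side G G₁ d₁
  side₁ = record
    { φ          = φ₁
    ; φ-inj      = φ₁-inj
    ; Over       = λ g e → Σ (e ≢ d₁) λ p → ψ⇒ g ≡ inj₁ (e , p)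
    ; over-≢     = proj₁
    ; over-inj   = λ (_ , p) (_ , q) → ψ-inj (trans p (sym q))
    ; over-fun   = λ (_ , p) (_ , q) → cong proj₁ (inj₁-injective (trans (sym p) q))
    ; over-joins = λ (e≢d , p) → ends₁ _ _ e≢d p
    ; lift       = λ e≢d → ψ⇐ (inj₁ (_ , e≢d)) , e≢d , strictlyInverseˡ _
    }

  side₂ : Side G G₂ d₂
  side₂ = record
    { φ          = φ₂
    ; φ-inj      = φ₂-inj
    ; Over       = λ g e → Σ (e ≢ d₂) λ p → ψ⇒ g ≡ inj₂ (e , p)
    ; over-≢     = proj₁
    ; over-inj   = λ (_ , p) (_ , q) → ψ-inj (trans p (sym q))
    ; over-fun   = λ (_ , p) (_ , q) → cong proj₁ (inj₂-injective (trans (sym p) q))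
    ; over-joins = λ (e≢d , p) → ends₂ _ _ e≢d p
    ; lift       = λ e≢d → ψ⇐ (inj₂ (_ , e≢d)) , e≢d , strictlyInverseˡ _
    }

  sum-glued : Glued side₁ side₂
  sum-glued = record
    { cover    = covers
    ; disjoint = λ { (_ , p) (_ , q) → case trans (sym p) q of λ () }
    ; seam     = glues glue
    ; meet     = λ eq → meets glue eq (glueOnly _ _ eq)
    }
    where
    Glue = (φ₁ x₁ ≡ φ₂ x₂ × φ₁ y₁ ≡ φ₂ y₂) ⊎ (φ₁ x₁ ≡ φ₂ y₂ × φ₁ y₁ ≡ φ₂ x₂)

    covers : ∀ g → (∃ λ e → Side.Over side₁ g e) ⊎ (∃ λ e → Side.Over side₂ g e)
    covers g with ψ⇒ g in eq
    ... | inj₁ (e , e≢d) = inj₁ (e , e≢d , refl)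
    ... | inj₂ (e , e≢d) = inj₂ (e , e≢d , refl)

    glues : Glue → ∃ λ a₁ → ∃ λ b₁ → ∃ λ a₂ → ∃ λ b₂ →
            Joins G₁ d₁ a₁ b₁ × Joins G₂ d₂ a₂ b₂ × φ₁ a₁ ≡ φ₂ a₂ × φ₁ b₁ ≡ φ₂ b₂
    glues (inj₁ (p , q)) = x₁ , y₁ , x₂ , y₂ , inj₁ refl , inj₁ refl , p , q
    glues (inj₂ (p , q)) = x₁ , y₁ , y₂ , x₂ , inj₁ refl , inj₂ refl , p , q

    meets : Glue → ∀ {a₁ a₂} → φ₁ a₁ ≡ φ₂ a₂ → a₁ ≡ x₁ ⊎ a₁ ≡ y₁ →
            ∃ λ b₁ → ∃ λ b₂ → Joins G₁ d₁ a₁ b₁ × Joins G₂ d₂ a₂ b₂ × φ₁ b₁ ≡ φ₂ b₂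
    meets (inj₁ (p , q)) eq (inj₁ refl) with φ₂-inj (trans (sym eq) p)
    ... | refl = y₁ , y₂ , inj₁ refl , inj₁ refl , q
    meets (inj₁ (p , q)) eq (inj₂ refl) with φ₂-inj (trans (sym eq) q)
    ... | refl = x₁ , x₂ , inj₂ refl , inj₂ refl , p
    meets (inj₂ (p , q)) eq (inj₁ refl) with φ₂-inj (trans (sym eq) p)
    ... | refl = y₁ , x₂ , inj₁ refl , inj₂ refl , q
    meets (inj₂ (p , q)) eq (inj₂ refl) with φ₂-inj (trans (sym eq) q)
    ... | refl = x₁ , y₂ , inj₂ refl , inj₁ refl , p

  sumSet-class : ∀ {A₁ : EdgeSet G₁} {A₂ : EdgeSet G₂} {c c₁ c₂ b} → Agree sum-glued c c₁ c₂ →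
                 (∀ {e} → A₁ e ⇔ c₁ e ≡ b) → (∀ {e} → A₂ e ⇔ c₂ e ≡ b) →
                 ∀ {g} → sumSet σ A₁ A₂ g ⇔ c g ≡ b
  sumSet-class A A₁⇔ A₂⇔ {g} with ψ⇒ g in eq
  ... | inj₁ (_ , p) = mk⇔ (trans (agree₁ A (p , eq)) ∘ to A₁⇔) (from A₁⇔ ∘ trans (sym (agree₁ A (p , eq))))
  ... | inj₂ (_ , p) = mk⇔ (trans (agree₂ A (p , eq)) ∘ to A₂⇔) (from A₂⇔ ∘ trans (sym (agree₂ A (p , eq))))

mainTheorem15 : (G G₁ G₂ : Graph) (d₁ : Edge G₁) (d₂ : Edge G₂) →
    Bispanning G₁ → Bispanning G₂ →
    (σ : TwoCliqueSum G G₁ G₂ d₁ d₂) →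
    (S T : EdgeSet G) (S₁ T₁ : EdgeSet G₁) (S₂ T₂ : EdgeSet G₂) →
    IsBispanningPair G S T → IsBispanningPair G₁ S₁ T₁ → IsBispanningPair G₂ S₂ T₂ →
    (∀ g → S g ⇔ sumSet σ S₁ S₂ g) → (∀ g → T g ⇔ sumSet σ T₁ T₂ g) →
    HasUECBO G₁ S₁ T₁ → HasUECBO G₂ S₂ T₂ → HasUECBO G S T
mainTheorem15 G G₁ G₂ d₁ d₂ _ _ σ S T S₁ T₁ S₂ T₂ pair pair₁ pair₂ S-sum T-sum u₁ u₂
  with bispanning-colouring {G₁} pair₁ | bispanning-colouring {G₂} pair₂
... | c₁ , S₁⇔ , T₁⇔ | c₂ , S₂⇔ , T₂⇔ =
  ordering⇒uecbo S⇔ T⇔ tree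
    (ordering-sum K (uecbo⇒ordering S₁⇔ T₁⇔ tree₁ u₁) (uecbo⇒ordering S₂⇔ T₂⇔ tree₂ u₂))
  where
  Γ = sum-glued σ

  c : Colouring G
  c = union Γ c₁ c₂

  agreement = union-agree Γ c₁ c₂

  S⇔ : ∀ {g} → S g ⇔ c g ≡ true
  S⇔ {g} = sumSet-class σ agreement S₁⇔ S₂⇔ ⇔-∘ S-sum g

  T⇔ : ∀ {g} → T g ⇔ c g ≡ false
  T⇔ {g} = sumSet-class σ agreement T₁⇔ T₂⇔ ⇔-∘ T-sum g

  tree  = bispanning-biTree {G} S⇔ T⇔ pair
  tree₁ = bispanning-biTree {G₁} S₁⇔ T₁⇔ pair₁
  tree₂ = bispanning-biTree {G₂} S₂⇔ T₂⇔ pair₂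

  K : Config (side₁ σ) (side₂ σ) c c₁ c₂
  K = record
    { glued    = Γ
    ; agree    = agreement
    ; tree₁    = tree₁
    ; tree₂    = tree₂
    ; opposite = opposite-colours Γ agreement tree tree₁ tree₂
    }
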